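{- For every real $K>0$ there is an integer $m\ge 2$ such that $\pi^-\bigl(S_2(m,0)\bigr)>K$. One may take any integer $L>2K$ and then $m=2^{L^2}+1$.
   Context: For $m\ge2$, $S_2(m,0)=\{X\subseteq[m]:|X|\le2\}$, ordered by inclusion. A family $\mathcal G$ of sets is a weak copy of a finite poset $(P,\leqslant)$ if there is a bijection $\psi:P\to\mathcal G$ such that $\psi(p)\subseteq\psi(p')$ whenever $p\leqslant p'$. A family $\mathcal F$ is (weak) $P$-free if no subfamily of it is a weak copy of $P$. $\mathrm{La}(n,P)$ is the maximum size of a weak $P$-free family $\mathcal F\subseteq 2^{[n]}$, where $[n]=\{1,\dots,n\}$, and $\pi^-(P)=\liminf_{n\to\infty}\mathrm{La}(n,P)/\binom{n}{\lfloor n/2\rfloor}$. -}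

module Defs where

open import Data.Empty using (⊥)
open import Data.Fin.Base using (Fin; zero; suc)
open import Data.Fin.Properties as Fin using (injective⇒≤)
open import Data.Fin.Subset using (Subset; inside; outside; ∣_∣; _⊆_)
open import Data.Fin.Subset.Properties
  using (⊆-poset; _⊆?_; ⊆-antisym; anySubset?; ∣⊥∣≡0)
open import Data.Integer.Base using (ℤ; +_)
open import Data.List.Base as List using (List; []; _∷_; _++_; length)
open import Data.List.Membership.Propositional using (_∈_)
open import Data.List.Membership.Propositional.Properties
  using (∈-map⁺; ∈-++⁺ˡ; ∈-++⁺ʳ; ∈-lookup)
import Data.List.Membership.DecPropositional as DecMembership
open import Data.List.Relation.Unary.All as All using (All)
open import Data.List.Relation.Unary.Any as Any using (Any; here; there)
open import Data.List.Relation.Unary.Any.Properties using (lookup-index)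
open import Data.List.Relation.Unary.Enumerates.Setoid using (IsEnumeration)
import Data.List.Relation.Unary.Unique.DecPropositional as DecUnique
open import Data.List.Relation.Unary.Unique.Propositional using (Unique)
open import Data.List.Relation.Unary.AllPairs using ([]; _∷_)
open import Data.Nat.Base as ℕ using (ℕ; zero; suc; ⌊_/2⌋; NonZero; z≤n; s≤s)
open import Data.Nat.Combinatorics using (_C_; nCk+nC[k+1]≡[n+1]C[k+1])
import Data.Nat.Properties as ℕ
open import Data.Product.Base using (Σ; ∃; _×_; _,_; proj₁; proj₂)
open import Data.Rational.Base as ℚ using (ℚ; 0ℚ; 1ℚ; ½; _/_)
import Data.Rational.Properties as ℚ
open import Data.Sum.Base using (_⊎_; inj₁; inj₂)
open import Data.Vec.Base as Vec using (Vec; []; _∷_)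
import Data.Vec.Properties as Vec
import Data.Bool.Properties as Bool
open import Function.Base using (_∘_)
open import Level using (0ℓ)
open import Relation.Binary.Bundles using (Poset; DecPoset)
import Relation.Binary.Construct.On as On
open import Relation.Binary.Definitions using (DecidableEquality; tri<; tri≈; tri>)
open import Relation.Binary.PropositionalEquality
  using (_≡_; refl; sym; trans; cong; subst)
open import Relation.Nullary using (¬_; Dec; yes; no; contradiction)
open import Relation.Nullary.Decidable as Dec using (_×-dec_; _→-dec_; ¬?)
open import Relation.Unary using (Pred; Decidable)

------------------------------------------------------------------------
-- Real numbers

-- A rounded lower cut of rationals.  Neither boundedness nor inhabitation is
-- required, so ±∞ are included.

record LowerReal : Set₁ where
  field
    Below   : ℚ → Set
    down    : ∀ {q r} → q ℚ.< r → Below r → Below q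
    rounded : ∀ {q} → Below q → ∃ λ r → q ℚ.< r × Below r

-- Dedekind reals.

record ℝ : Set₁ where
  field
    lower : LowerReal
  open LowerReal lower public
  field
    Above         : ℚ → Set
    up            : ∀ {q r} → q ℚ.< r → Above q → Above r
    above-rounded : ∀ {r} → Above r → ∃ λ q → q ℚ.< r × Above q
    below-inhab   : ∃ Below
    above-inhab   : ∃ Above
    disjoint      : ∀ {q} → Below q → Above q → ⊥
    located       : ∀ {q r} → q ℚ.< r → Below q ⊎ Above r

open ℝ using (lower)

infix 4 _<ˡ_ _<ʳ_

_<ˡ_ : ℝ → LowerReal → Set
x <ˡ y = ∃ λ q → ℝ.Above x q × LowerReal.Below y q

_<ʳ_ : ℝ → ℝ → Set
x <ʳ y = x <ˡ lower y

private
  q<q+1 : ∀ q → q ℚ.< q ℚ.+ 1ℚ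
  q<q+1 q = subst (ℚ._< q ℚ.+ 1ℚ) (ℚ.+-identityʳ q) (ℚ.+-monoʳ-< q (ℚ.positive⁻¹ 1ℚ))

  q-1<q : ∀ q → q ℚ.- 1ℚ ℚ.< q
  q-1<q q = subst (q ℚ.- 1ℚ ℚ.<_) (ℚ.+-identityʳ q) (ℚ.+-monoʳ-< q (ℚ.negative⁻¹ (ℚ.- 1ℚ)))

fromℚ : ℚ → ℝ
fromℚ p = record
  { lower = record
    { Below   = ℚ._< p
    ; down    = ℚ.<-trans
    ; rounded = λ q<p → let r , q<r , r<p = ℚ.<-dense q<p in r , q<r , r<p
    }
  ; Above         = p ℚ.<_
  ; up            = λ q<r p<q → ℚ.<-trans p<q q<r
  ; above-rounded = λ p<r → let q , p<q , q<r = ℚ.<-dense p<r in q , q<r , p<q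
  ; below-inhab   = p ℚ.- 1ℚ , q-1<q p
  ; above-inhab   = p ℚ.+ 1ℚ , q<q+1 p
  ; disjoint      = ℚ.<-asym
  ; located       = loc
  }
  where
  loc : ∀ {q r} → q ℚ.< r → q ℚ.< p ⊎ p ℚ.< r
  loc {q} q<r with ℚ.<-cmp q p
  ... | tri< q<p _ _ = inj₁ q<p
  ... | tri≈ _ q≡p _ = inj₂ (subst (ℚ._< _) q≡p q<r)
  ... | tri> _ _ p<q = inj₂ (ℚ.<-trans p<q q<r)

fromℤ : ℤ → ℝ
fromℤ z = fromℚ (z / 1)

0ℝ : ℝ
0ℝ = fromℚ 0ℚ

private
  2ℚ : ℚ
  2ℚ = + 2 / 1

  ½2 : ∀ q → ½ ℚ.* (2ℚ ℚ.* q) ≡ q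
  ½2 q = trans (sym (ℚ.*-assoc ½ 2ℚ q)) (ℚ.*-identityˡ q)

  2½ : ∀ q → 2ℚ ℚ.* (½ ℚ.* q) ≡ q
  2½ q = trans (sym (ℚ.*-assoc 2ℚ ½ q)) (ℚ.*-identityˡ q)

  ½-mono : ∀ {q r} → q ℚ.< r → ½ ℚ.* q ℚ.< ½ ℚ.* r
  ½-mono = ℚ.*-monoʳ-<-pos ½

  2-mono : ∀ {q r} → q ℚ.< r → 2ℚ ℚ.* q ℚ.< 2ℚ ℚ.* r
  2-mono = ℚ.*-monoʳ-<-pos 2ℚ

-- q < 2x iff q/2 < x.

2·_ : ℝ → ℝ
2· x = record
  { lower = record
    { Below   = λ q → Below (½ ℚ.* q)
    ; down    = λ q<r → down (½-mono q<r)
    ; rounded = λ {q} b → let r , lt , b′ = rounded b in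
        2ℚ ℚ.* r , subst (ℚ._< 2ℚ ℚ.* r) (2½ q) (2-mono lt) , subst Below (sym (½2 r)) b′
    }
  ; Above         = λ q → Above (½ ℚ.* q)
  ; up            = λ q<r → up (½-mono q<r)
  ; above-rounded = λ {r} a → let q , lt , a′ = above-rounded a in
      2ℚ ℚ.* q , subst (2ℚ ℚ.* q ℚ.<_) (2½ r) (2-mono lt) , subst Above (sym (½2 q)) a′
  ; below-inhab   = let q , b = below-inhab in 2ℚ ℚ.* q , subst Below (sym (½2 q)) b
  ; above-inhab   = let q , a = above-inhab in 2ℚ ℚ.* q , subst Above (sym (½2 q)) a
  ; disjoint      = disjoint
  ; located       = λ q<r → located (½-mono q<r)
  }
  where open ℝ x

-- sup_N inf_{n ≥ N} a n.  A rational q lies below it iff, for some N,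
-- q lies strictly below a rational lower bound of the tail from N on.

liminf : (ℕ → ℚ) → LowerReal
liminf a = record
  { Below   = λ q → ∃ λ r → q ℚ.< r × (∃ λ N → ∀ n → N ℕ.≤ n → r ℚ.≤ a n)
  ; down    = λ q<r (s , r<s , e) → s , ℚ.<-trans q<r r<s , e
  ; rounded = λ (s , q<s , e) → let r , q<r , r<s = ℚ.<-dense q<s in r , q<r , s , r<s , e
  }

------------------------------------------------------------------------
-- Finite posets and families of sets

-- Nonempty because every family contains a weak copy of the empty poset, so
-- that La(n,P) is undefined for it.  Decidability is automatic classically.

record FinitePoset : Set₁ where
  field
    decPoset : DecPoset 0ℓ 0ℓ 0ℓ
  open DecPoset decPoset public renaming (refl to ≤-refl; trans to ≤-trans)
  field
    elements    : List Carrier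
    enumeration : IsEnumeration Eq.setoid elements
    nonempty    : Carrier

-- A finite set of subsets of [n], listed without repetition; the order of the
-- list is never used.

record Family (n : ℕ) : Set where
  constructor family
  field
    members : List (Subset n)
    unique  : Unique members

open Family public

size : ∀ {n} → Family n → ℕ
size = length ∘ members

_∈ᶠ_ : ∀ {n} → Subset n → Family n → Set
X ∈ᶠ 𝓕 = X ∈ members 𝓕

_⊆ᶠ_ : ∀ {n} → Family n → Family n → Set
𝓖 ⊆ᶠ 𝓕 = ∀ {X} → X ∈ᶠ 𝓖 → X ∈ᶠ 𝓕

-- ψ is a bijection from the carrier modulo _≈_ onto 𝓖; that it respects _≈_
-- follows from monotone and antisymmetry of _⊆_.

record IsWeakCopy {n : ℕ} (P : FinitePoset) (𝓖 : Family n) : Set where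
  open FinitePoset P
  field
    ψ          : Carrier → Subset n
    ψ-∈        : ∀ p → ψ p ∈ᶠ 𝓖
    injective  : ∀ {p p′} → ψ p ≡ ψ p′ → p ≈ p′
    surjective : ∀ {X} → X ∈ᶠ 𝓖 → ∃ λ p → ψ p ≡ X
    monotone   : ∀ {p p′} → p ≤ p′ → ψ p ⊆ ψ p′

Free : ∀ {n} → FinitePoset → Family n → Set
Free P 𝓕 = ¬ (∃ λ 𝓖 → 𝓖 ⊆ᶠ 𝓕 × IsWeakCopy P 𝓖)

record IsMaxFreeSize (n : ℕ) (P : FinitePoset) (k : ℕ) : Set where
  field
    attained : ∃ λ (𝓕 : Family n) → Free P 𝓕 × size 𝓕 ≡ k
    bound    : ∀ (𝓕 : Family n) → Free P 𝓕 → size 𝓕 ℕ.≤ k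

powerset : ∀ n → List (Subset n)
powerset zero    = [] ∷ []
powerset (suc n) = List.map (outside ∷_) (powerset n) ++ List.map (inside ∷_) (powerset n)

∈-powerset : ∀ {n} (X : Subset n) → X ∈ powerset n
∈-powerset []            = here refl
∈-powerset (outside ∷ X) = ∈-++⁺ˡ (∈-map⁺ (outside ∷_) (∈-powerset X))
∈-powerset (inside  ∷ X) = ∈-++⁺ʳ _ (∈-map⁺ (inside ∷_) (∈-powerset X))

private
  _≟ˢ_ : ∀ {n} → DecidableEquality (Subset n)
  _≟ˢ_ = Vec.≡-dec Bool._≟_

  lookup-injective : ∀ {A : Set} {xs : List A} → Unique xs →
                     ∀ i j → List.lookup xs i ≡ List.lookup xs j → i ≡ j
  lookup-injective (_ ∷ _)  zero    zero    _  = refl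
  lookup-injective (x∉ ∷ _) zero    (suc j) eq = contradiction eq (All.lookup x∉ (∈-lookup j))
  lookup-injective (x∉ ∷ _) (suc i) zero    eq = contradiction (sym eq) (All.lookup x∉ (∈-lookup i))
  lookup-injective (_ ∷ u)  (suc i) (suc j) eq = cong suc (lookup-injective u i j eq)

  size≤ : ∀ {n} (𝓕 : Family n) → size 𝓕 ℕ.≤ length (powerset n)
  size≤ {n} (family xs u) = injective⇒≤ {f = f} f-inj
    where
    f : Fin (length xs) → Fin (length (powerset n))
    f i = Any.index (∈-powerset (List.lookup xs i))

    f-inj : ∀ {i j} → f i ≡ f j → i ≡ j
    f-inj {i} {j} eq = lookup-injective u i j
      (trans (lookup-index (∈-powerset (List.lookup xs i)))
      (trans (cong (List.lookup (powerset n)) eq)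
             (sym (lookup-index (∈-powerset (List.lookup xs j))))))

  anyList? : ∀ {n} k {Q : Pred (List (Subset n)) 0ℓ} → Decidable Q →
             Dec (∃ λ xs → length xs ≡ k × Q xs)
  anyList? zero Q? = Dec.map′ (λ q → [] , refl , q) (λ { ([] , refl , q) → q }) (Q? [])
  anyList? (suc k) Q? = Dec.map′
    (λ (X , xs , eq , q) → X ∷ xs , cong suc eq , q)
    (λ { (X ∷ xs , eq , q) → X , xs , ℕ.suc-injective eq , q })
    (anySubset? λ X → anyList? k (Q? ∘ (X ∷_)))

  anyVec? : ∀ {n} k {Q : Pred (Vec (Subset n) k) 0ℓ} → Decidable Q → Dec (∃ Q)
  anyVec? zero    Q? = Dec.map′ ([] ,_) (λ { ([] , q) → q }) (Q? [])
  anyVec? (suc k) Q? = Dec.map′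
    (λ (X , v , q) → X ∷ v , q)
    (λ { (X ∷ v , q) → X , v , q })
    (anySubset? λ X → anyVec? k (Q? ∘ (X ∷_)))

  -- Either the largest k ≤ b satisfying Q, or none.
  largest : ∀ {Q : ℕ → Set} → Decidable Q → ∀ b →
            (∃ λ k → Q k × (∀ j → j ℕ.≤ b → Q j → j ℕ.≤ k)) ⊎ (∀ j → j ℕ.≤ b → ¬ Q j)
  largest Q? zero with Q? zero
  ... | yes q = inj₁ (zero , q , λ j j≤0 _ → j≤0)
  ... | no ¬q = inj₂ λ { zero z≤n q → ¬q q }
  largest {Q} Q? (suc b) with Q? (suc b)
  ... | yes q = inj₁ (suc b , q , λ j j≤b _ → j≤b)
  ... | no ¬q with largest Q? b
  ...   | inj₁ (k , qk , m) = inj₁ (k , qk , λ j j≤ q → m j (smaller j≤ q) q)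
    where
    smaller : ∀ {j} → j ℕ.≤ suc b → Q j → j ℕ.≤ b
    smaller j≤ q = ℕ.s≤s⁻¹ (ℕ.≤∧≢⇒< j≤ λ { refl → ¬q q })
  ...   | inj₂ none = inj₂ λ j j≤ q →
            none j (ℕ.s≤s⁻¹ (ℕ.≤∧≢⇒< j≤ λ { refl → ¬q q })) q

  anyFamily? : ∀ {n} {Q : Pred (Family n) 0ℓ} →
               (∀ {𝓕 𝓖} → members 𝓕 ≡ members 𝓖 → Q 𝓕 → Q 𝓖) →
               Decidable Q → ∀ k → Dec (∃ λ 𝓕 → Q 𝓕 × size 𝓕 ≡ k)
  anyFamily? {n} {Q} resp Q? k = Dec.map′
    (λ (xs , eq , u , q) → family xs u , q , eq)
    (λ (𝓕 , q , eq) → members 𝓕 , eq , unique 𝓕 , q)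
    (anyList? k dec)
    where
    dec : Decidable (λ xs → Σ (Unique xs) (Q ∘ family xs))
    dec xs with DecUnique.unique? _≟ˢ_ xs
    ... | no ¬u = no (¬u ∘ proj₁)
    ... | yes u = Dec.map′ (u ,_) (λ (_ , q) → resp refl q) (Q? (family xs u))

  module _ {n : ℕ} (P : FinitePoset) where
    open FinitePoset P

    private
      k : ℕ
      k = length elements

      e : Fin k → Carrier
      e = List.lookup elements

      idx : Carrier → Fin k
      idx x = Any.index (enumeration x)

      e-idx : ∀ x → x ≈ e (idx x)
      e-idx x = lookup-index (enumeration x)

      e-idx≤ : ∀ x → e (idx x) ≤ x
      e-idx≤ x = reflexive (Eq.sym (e-idx x))

      ≤e-idx : ∀ x → x ≤ e (idx x)
      ≤e-idx x = reflexive (e-idx x)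

      Good : Family n → Vec (Subset n) k → Set
      Good 𝓖 v =
        (∀ i → Vec.lookup v i ∈ᶠ 𝓖) ×
        (∀ i j → Vec.lookup v i ≡ Vec.lookup v j → e i ≈ e j) ×
        All (λ X → ∃ λ i → Vec.lookup v i ≡ X) (members 𝓖) ×
        (∀ i j → e i ≤ e j → Vec.lookup v i ⊆ Vec.lookup v j)

      good? : ∀ 𝓖 → Decidable (Good 𝓖)
      good? 𝓖 v =
        Fin.all? (λ i → DecMembership._∈?_ _≟ˢ_ _ (members 𝓖)) ×-dec
        Fin.all? (λ i → Fin.all? λ j → (_ ≟ˢ _) →-dec (e i ≟ e j)) ×-dec
        All.all? (λ X → Fin.any? λ i → _ ≟ˢ X) (members 𝓖) ×-dec
        Fin.all? (λ i → Fin.all? λ j → (e i ≤? e j) →-dec (_ ⊆? _))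

      to : ∀ {𝓖} → ∃ (Good 𝓖) → IsWeakCopy P 𝓖
      to (v , mem , inj , sur , mon) = record
        { ψ          = λ p → Vec.lookup v (idx p)
        ; ψ-∈        = λ p → mem (idx p)
        ; injective  = λ {p} {p′} eq →
            Eq.trans (e-idx p) (Eq.trans (inj _ _ eq) (Eq.sym (e-idx p′)))
        ; surjective = λ X∈ → let i , eq = All.lookup sur X∈ in
            e i , trans (⊆-antisym (mon _ _ (e-idx≤ (e i))) (mon _ _ (≤e-idx (e i)))) eq
        ; monotone   = λ {p} {p′} p≤p′ →
            mon _ _ (≤-trans (e-idx≤ p) (≤-trans p≤p′ (≤e-idx p′)))
        }

      from : ∀ {𝓖} → IsWeakCopy P 𝓖 → ∃ (Good 𝓖)
      from {𝓖} w = v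
        , (λ i → subst (_∈ᶠ 𝓖) (sym (v≡ i)) (ψ-∈ (e i)))
        , (λ i j eq → injective (trans (sym (v≡ i)) (trans eq (v≡ j))))
        , All.tabulate (λ X∈ → let p , eq = surjective X∈ in idx p ,
            trans (v≡ (idx p))
              (trans (⊆-antisym (monotone (e-idx≤ p)) (monotone (≤e-idx p))) eq))
        , (λ i j le {x} → subst (λ X → x Data.Fin.Subset.∈ X) (sym (v≡ j))
             ∘ monotone le ∘ subst (λ X → x Data.Fin.Subset.∈ X) (v≡ i))
        where
        open IsWeakCopy w
        v : Vec (Subset n) k
        v = Vec.tabulate (ψ ∘ e)
        v≡ : ∀ i → Vec.lookup v i ≡ ψ (e i)
        v≡ = Vec.lookup∘tabulate (ψ ∘ e)

    isWeakCopy? : Decidable {A = Family n} (IsWeakCopy P)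
    isWeakCopy? 𝓖 = Dec.map′ to from (anyVec? k (good? 𝓖))

    resp-copy : ∀ {𝓖 𝓗 : Family n} → members 𝓖 ≡ members 𝓗 →
                IsWeakCopy P 𝓖 → IsWeakCopy P 𝓗
    resp-copy {family _ _} {family _ _} refl w = record { IsWeakCopy w }

    resp-free : ∀ {𝓕 𝓖 : Family n} → members 𝓕 ≡ members 𝓖 → Free P 𝓕 → Free P 𝓖
    resp-free {family _ _} {family _ _} refl free (𝓗 , ⊆ , w) = free (𝓗 , ⊆ , w)

    free? : Decidable {A = Family n} (Free P)
    free? 𝓕 = ¬? (Dec.map′
      (λ (_ , _ , 𝓖 , (sub , w) , _) → 𝓖 , (λ X∈ → All.lookup sub X∈) , w)
      (λ (𝓖 , sub , w) →
        size 𝓖 , s≤s (size≤ 𝓖) , 𝓖 , (All.tabulate sub , w) , refl)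
      (ℕ.anyUpTo? (anyFamily? resp dec) (suc (length (powerset n)))))
      where
      Sub : Family n → Set
      Sub 𝓖 = All (_∈ᶠ 𝓕) (members 𝓖) × IsWeakCopy P 𝓖

      resp : ∀ {𝓖 𝓗} → members 𝓖 ≡ members 𝓗 → Sub 𝓖 → Sub 𝓗
      resp {𝓖} {𝓗} eq (sub , w) =
        subst (All (_∈ᶠ 𝓕)) eq sub , resp-copy {𝓖} {𝓗} eq w

      dec : Decidable Sub
      dec 𝓖 = All.all? (λ X → DecMembership._∈?_ _≟ˢ_ X (members 𝓕)) (members 𝓖)
              ×-dec isWeakCopy? 𝓖

    ∅-free : Free P (family {n} [] [])
    ∅-free (𝓖 , sub , w) with sub (IsWeakCopy.ψ-∈ w nonempty)
    ... | ()

-- The maximum exists, by exhaustive search over families.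

abstract
  maxFreeSize : ∀ n P → ∃ (IsMaxFreeSize n P)
  maxFreeSize n P with largest (anyFamily? (λ {𝓕} {𝓖} → resp-free P {𝓕} {𝓖}) (free? P))
                               (length (powerset n))
  ... | inj₁ (k , att , max) = k , record
    { attained = att
    ; bound    = λ 𝓕 free → max (size 𝓕) (size≤ 𝓕) (𝓕 , free , refl)
    }
  ... | inj₂ none = contradiction (family [] [] , ∅-free P , refl) (none 0 z≤n)

La : ℕ → FinitePoset → ℕ
La n P = proj₁ (maxFreeSize n P)

La-isMax : ∀ n P → IsMaxFreeSize n P (La n P)
La-isMax n P = proj₂ (maxFreeSize n P)

nCk-nonZero : ∀ {n k} → k ℕ.≤ n → NonZero (n C k)
nCk-nonZero {n} {zero}  _ = _
nCk-nonZero {suc n} {suc k} (s≤s k≤n) =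
  subst NonZero (nCk+nC[k+1]≡[n+1]C[k+1] n k) (+-nonZero (nCk-nonZero k≤n))
  where
  +-nonZero : ∀ {a b} → NonZero a → NonZero (a ℕ.+ b)
  +-nonZero {suc _} _ = _

π⁻ : FinitePoset → LowerReal
π⁻ P = liminf λ n → (+ La n P / (n C ⌊ n /2⌋)) {{nCk-nonZero (ℕ.⌊n/2⌋≤n n)}}

------------------------------------------------------------------------
-- The poset of subsets of [m] of size at most two

⊆-decPoset : ℕ → DecPoset 0ℓ 0ℓ 0ℓ
⊆-decPoset m = record
  { isDecPartialOrder = record
    { isPartialOrder = Poset.isPartialOrder (⊆-poset m)
    ; _≟_            = _≟ˢ_
    ; _≤?_           = _⊆?_
    }
  }

-- The order and equality are those of the underlying subsets.

S₂[_,0] : ℕ → FinitePoset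
S₂[ m ,0] = record
  { decPoset    = On.decPoset (⊆-decPoset m) proj₁
  ; elements    = restrict (powerset m)
  ; enumeration = λ (X , small) → ∈-restrict (∈-powerset X) small
  ; nonempty    = Data.Fin.Subset.⊥ , subst (ℕ._≤ 2) (sym (∣⊥∣≡0 m)) z≤n
  }
  where
  Small : Set
  Small = ∃ λ (X : Subset m) → ∣ X ∣ ℕ.≤ 2

  restrict : List (Subset m) → List Small
  restrict [] = []
  restrict (X ∷ Xs) with ∣ X ∣ ℕ.≤? 2
  ... | yes small = (X , small) ∷ restrict Xs
  ... | no  _     = restrict Xs

  ∈-restrict : ∀ {X Xs} → X ∈ Xs → ∣ X ∣ ℕ.≤ 2 → Any (λ Y → X ≡ proj₁ Y) (restrict Xs)
  ∈-restrict {X} {Y ∷ _} X∈ small with ∣ Y ∣ ℕ.≤? 2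
  ∈-restrict (here refl) small | yes _  = here refl
  ∈-restrict (there X∈)  small | yes _  = there (∈-restrict X∈ small)
  ∈-restrict (here refl) small | no big = contradiction small big
  ∈-restrict (there X∈)  small | no _   = ∈-restrict X∈ small

{-# OPTIONS --safe #-}
module Submission where

open import Data.Integer.Base using (ℤ; ∣_∣)
open import Data.Nat.Base using (ℕ; _≤_; _+_; _^_)
open import Data.Product.Base using (∃; _×_)
open import Defs

open import Data.Bool.Base using (Bool; true; false; _∧_; _xor_; if_then_else_)
open import Data.Bool.Properties as Bool
  using (xor-assoc; xor-comm; xor-same; xor-identityʳ; ∧-zeroʳ; ∧-distribˡ-xor)
open import Data.Fin.Base using (Fin; zero; suc; combine)
open import Data.Fin.Properties using (combine-injective; pigeonhole; <⇒≢)
open import Data.Fin.Subset using (Subset; _⊆_; _∪_; ⁅_⁆)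
  renaming (∣_∣ to ∥_∥; ⊥ to ∅; _∈_ to _∈ˢ_)
open import Data.Fin.Subset.Properties
  using (_⊆?_; ⊆-refl; ⊆-trans; ⊆-antisym; anySubset?; ∣⊥∣≡0; ∣⁅x⁆∣≡1; p⊆p∪q; q⊆p∪q;
         x∈⁅y⁆⇒x≡y; x∈⁅x⁆; ⊥⊆; drop-∷-⊆; s⊆s; out⊆)
open import Data.Integer.Base as ℤ using (-[1+_]) renaming (+_ to ⁺_)
import Data.Integer.Properties as ℤ
open import Data.List.Base as List using (List; _++_; length)
open import Data.List.Membership.Propositional using (_∈_)
open import Data.List.Membership.Propositional.Properties using (∈-map⁻; ∈-++⁻)
import Data.List.Properties as List
import Data.List.Relation.Unary.All as All
import Data.List.Relation.Unary.AllPairs as AllPairs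
import Data.List.Relation.Unary.Any as Any
open import Data.List.Relation.Unary.Unique.Propositional using (Unique)
import Data.List.Relation.Unary.Unique.Propositional.Properties as Unique
open import Data.Nat.Base using (zero; suc; _*_; _<_; z≤n; s≤s; ⌊_/2⌋; NonZero)
open import Data.Nat.Combinatorics using (_C_; nCk+nC[k+1]≡[n+1]C[k+1]; nC1≡n)
open import Data.Nat.Properties as ℕ using (_≤?_; _<?_; _≟_)
open import Data.Nat.Tactic.RingSolver using (solve-∀)
open import Data.Product.Base using (_,_; proj₁; proj₂)
open import Data.Rational.Base as ℚ using (ℚ; mkℚ; ½; ↥_; ↧_)
import Data.Rational.Properties as ℚ
open import Data.Rational.Unnormalised.Base as ℚᵘ using (mkℚᵘ)
import Data.Rational.Unnormalised.Properties as ℚᵘ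
open import Data.Sum.Base using (_⊎_; inj₁; inj₂)
open import Data.Vec.Base as Vec using (Vec; []; _∷_; here; there)
import Data.Vec.Properties as Vec
open import Function.Base using (_∘_; case_of_)
open import Relation.Binary.Definitions using (DecidableEquality)
open import Relation.Binary.PropositionalEquality
open import Relation.Nullary using (¬_; Dec; yes; no; does; contradiction)
open import Relation.Nullary.Decidable using (_×-dec_; ¬?; decidable-stable)

-- For a random linear map 𝔽₂ⁿ → 𝔽₂^(h+L), h = ⌊n/2⌋, a set with fewer than h + L elements has
-- linearly dependent images of its basis vectors with probability at most 1/2.  So some map M
-- makes at least half of the sets in the levels h, …, h + L - 1 independent, which is about
-- (L/2) C(n, h) sets.  In a weak copy of S₂(m,0) among these, the image A of ∅ spans a
-- subspace of codimension at most L, so the spans of the images Bᵢ of the singletons are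
-- among at most 2^(L²) subspaces.  Bᵢ and Bⱼ lie in a common independent set, hence are
-- equal if their spans are.

-- Sums over the cube

ind : {P : Set} → Dec P → ℕ
ind P? = if does P? then 1 else 0

ind-mono : {P Q : Set} (P? : Dec P) (Q? : Dec Q) → (P → Q) → ind P? ≤ ind Q?
ind-mono (no _)  _       _   = z≤n
ind-mono (yes _) (yes _) _   = ℕ.≤-refl
ind-mono (yes p) (no ¬q) imp = contradiction (imp p) ¬q

ind-cong : {P Q : Set} (P? : Dec P) (Q? : Dec Q) → (P → Q) → (Q → P) → ind P? ≡ ind Q?
ind-cong P? Q? to from = ℕ.≤-antisym (ind-mono P? Q? to) (ind-mono Q? P? from)

ind-× : {P Q : Set} (P? : Dec P) (Q? : Dec Q) → ind (P? ×-dec Q?) ≡ ind P? * ind Q?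
ind-× (no _)  _       = refl
ind-× (yes _) (no _)  = refl
ind-× (yes _) (yes _) = refl

ind-yes : {P : Set} (P? : Dec P) → P → ind P? ≡ 1
ind-yes (yes _) _ = refl
ind-yes (no ¬p) p = contradiction p ¬p

ind-¬ : {P : Set} (P? : Dec P) → ¬ P → ind P? ≡ 0
ind-¬ (yes p) ¬p = contradiction p ¬p
ind-¬ (no _)  _  = refl

∑ : ∀ {n} → (Subset n → ℕ) → ℕ
∑ {zero}  f = f []
∑ {suc n} f = ∑ (f ∘ (false ∷_)) + ∑ (f ∘ (true ∷_))

∑-mono : ∀ {n} {f g : Subset n → ℕ} → (∀ X → f X ≤ g X) → ∑ f ≤ ∑ g
∑-mono {zero}  f≤g = f≤g []
∑-mono {suc n} f≤g = ℕ.+-mono-≤ (∑-mono (f≤g ∘ (false ∷_))) (∑-mono (f≤g ∘ (true ∷_)))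

∑-cong : ∀ {n} {f g : Subset n → ℕ} → (∀ X → f X ≡ g X) → ∑ f ≡ ∑ g
∑-cong {zero}  f≡g = f≡g []
∑-cong {suc n} f≡g = cong₂ _+_ (∑-cong (f≡g ∘ (false ∷_))) (∑-cong (f≡g ∘ (true ∷_)))

+-exchange : ∀ a b c d → (a + b) + (c + d) ≡ (a + c) + (b + d)
+-exchange = solve-∀

∑-+ : ∀ {n} (f g : Subset n → ℕ) → ∑ (λ X → f X + g X) ≡ ∑ f + ∑ g
∑-+ {zero}  f g = refl
∑-+ {suc n} f g =
  trans (cong₂ _+_ (∑-+ (f ∘ (false ∷_)) (g ∘ (false ∷_))) (∑-+ (f ∘ (true ∷_)) (g ∘ (true ∷_))))
        (+-exchange (∑ (f ∘ (false ∷_))) _ _ _)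

∑-*ˡ : ∀ {n} k (f : Subset n → ℕ) → ∑ (λ X → k * f X) ≡ k * ∑ f
∑-*ˡ {zero}  k f = refl
∑-*ˡ {suc n} k f =
  trans (cong₂ _+_ (∑-*ˡ k (f ∘ (false ∷_))) (∑-*ˡ k (f ∘ (true ∷_))))
        (sym (ℕ.*-distribˡ-+ k (∑ (f ∘ (false ∷_))) _))

2*-double : ∀ a k → 2 * a * k ≡ a * k + a * k
2*-double = solve-∀

∑-const : ∀ n k → ∑ {n} (λ _ → k) ≡ 2 ^ n * k
∑-const zero    k = sym (ℕ.+-identityʳ k)
∑-const (suc n) k = trans (cong₂ _+_ (∑-const n k) (∑-const n k)) (sym (2*-double (2 ^ n) k))

∑-swap : ∀ {m n} (f : Subset m → Subset n → ℕ) →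
         ∑ (λ X → ∑ (f X)) ≡ ∑ (λ Y → ∑ (λ X → f X Y))
∑-swap {zero}  f = refl
∑-swap {suc m} f =
  trans (cong₂ _+_ (∑-swap (f ∘ (false ∷_))) (∑-swap (f ∘ (true ∷_))))
        (sym (∑-+ (λ Y → ∑ (λ X → f (false ∷ X) Y)) _))

-- The averaging principle, in the form of a search: of the two points found in the half cubes, the
-- one with the smaller value serves for the whole cube.
∑-min : ∀ {n} (f : Subset n → ℕ) → ∃ λ X → 2 ^ n * f X ≤ ∑ f
∑-min {zero}  f = [] , ℕ.≤-reflexive (ℕ.+-identityʳ _)
∑-min {suc n} f
  with ∑-min (f ∘ (false ∷_)) | ∑-min (f ∘ (true ∷_))
... | X , p | Y , q with ℕ.≤-total (f (false ∷ X)) (f (true ∷ Y))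
... | inj₁ fX≤fY = false ∷ X , ℕ.≤-trans (ℕ.≤-reflexive (2*-double (2 ^ n) _))
  (ℕ.+-mono-≤ p (ℕ.≤-trans (ℕ.*-monoʳ-≤ (2 ^ n) fX≤fY) q))
... | inj₂ fY≤fX = true ∷ Y , ℕ.≤-trans (ℕ.≤-reflexive (2*-double (2 ^ n) _))
  (ℕ.+-mono-≤ (ℕ.≤-trans (ℕ.*-monoʳ-≤ (2 ^ n) fY≤fX) p) q)

infix 4 _≟ˢ_

_≟ˢ_ : ∀ {n} → DecidableEquality (Subset n)
_≟ˢ_ = Vec.≡-dec Bool._≟_

f≤∑f : ∀ {n} (f : Subset n → ℕ) X → f X ≤ ∑ f
f≤∑f f []          = ℕ.≤-refl
f≤∑f f (false ∷ X) = ℕ.≤-trans (f≤∑f (f ∘ (false ∷_)) X) (ℕ.m≤m+n _ _)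
f≤∑f f (true ∷ X)  = ℕ.≤-trans (f≤∑f (f ∘ (true ∷_)) X) (ℕ.m≤n+m _ _)

∑-zero : ∀ {n} {P : Subset n → Set} (P? : ∀ Y → Dec (P Y)) → (∀ Y → ¬ P Y) → ∑ (ind ∘ P?) ≡ 0
∑-zero {n} P? ¬P = trans (∑-cong (λ Y → ind-¬ (P? Y) (¬P Y)))
  (trans (∑-const n 0) (ℕ.*-zeroʳ (2 ^ n)))

∑-point : ∀ {n} (X : Subset n) → ∑ (λ Y → ind (Y ≟ˢ X)) ≡ 1
∑-point []          = refl
∑-point (false ∷ X) = cong₂ _+_
  (trans (∑-cong λ Y → ind-cong (false ∷ Y ≟ˢ false ∷ X) (Y ≟ˢ X) Vec.∷-injectiveʳ (cong (false ∷_)))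
         (∑-point X))
  (∑-zero (λ Y → true ∷ Y ≟ˢ false ∷ X) λ _ ())
∑-point (true ∷ X)  = cong₂ _+_
  (∑-zero (λ Y → false ∷ Y ≟ˢ true ∷ X) λ _ ())
  (trans (∑-cong λ Y → ind-cong (true ∷ Y ≟ˢ true ∷ X) (Y ≟ˢ X) Vec.∷-injectiveʳ (cong (true ∷_)))
         (∑-point X))

∑-⊆ : ∀ {n} (X : Subset n) → ∑ (λ Y → ind (Y ⊆? X)) ≡ 2 ^ ∥ X ∥
∑-⊆ []          = refl
∑-⊆ (false ∷ X) = trans
  (cong₂ _+_
    (trans (∑-cong λ Y → ind-cong (false ∷ Y ⊆? false ∷ X) (Y ⊆? X) drop-∷-⊆ out⊆) (∑-⊆ X))
    (∑-zero (λ Y → true ∷ Y ⊆? false ∷ X) λ Y Y⊆X → case Y⊆X here of λ ()))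
  (ℕ.+-identityʳ _)
∑-⊆ (true ∷ X)  = cong₂ _+_
  (trans (∑-cong λ Y → ind-cong (false ∷ Y ⊆? true ∷ X) (Y ⊆? X) drop-∷-⊆ out⊆) (∑-⊆ X))
  (trans (trans (∑-cong λ Y → ind-cong (true ∷ Y ⊆? true ∷ X) (Y ⊆? X) drop-∷-⊆ s⊆s) (∑-⊆ X))
         (sym (ℕ.+-identityʳ _)))

∑-card : ∀ n k → ∑ {n} (λ X → ind (∥ X ∥ ≟ k)) ≡ n C k
∑-card zero    zero    = refl
∑-card zero    (suc k) = refl
∑-card (suc n) zero    = trans
  (cong₂ _+_ (∑-card n 0) (∑-zero (λ (X : Subset n) → suc ∥ X ∥ ≟ 0) λ _ ()))
  (ℕ.+-identityʳ _)
∑-card (suc n) (suc k) = trans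
  (cong₂ _+_ (∑-card n (suc k))
    (trans (∑-cong {n} λ X → ind-cong (suc ∥ X ∥ ≟ suc k) (∥ X ∥ ≟ k) ℕ.suc-injective (cong suc))
           (∑-card n k)))
  (trans (ℕ.+-comm (n C suc k) (n C k)) (nCk+nC[k+1]≡[n+1]C[k+1] n k))

-- Linear algebra over the field with two elements

infixl 6 _⊕_
infixl 7 _·_ _$ᴹ_

_⊕_ : ∀ {n} → Subset n → Subset n → Subset n
_⊕_ = Vec.zipWith _xor_

⊕-assoc : ∀ {n} (X Y Z : Subset n) → (X ⊕ Y) ⊕ Z ≡ X ⊕ (Y ⊕ Z)
⊕-assoc = Vec.zipWith-assoc xor-assoc

⊕-comm : ∀ {n} (X Y : Subset n) → X ⊕ Y ≡ Y ⊕ X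
⊕-comm = Vec.zipWith-comm xor-comm

⊕-identityʳ : ∀ {n} (X : Subset n) → X ⊕ ∅ ≡ X
⊕-identityʳ = Vec.zipWith-identityʳ xor-identityʳ

⊕-same : ∀ {n} (X : Subset n) → X ⊕ X ≡ ∅
⊕-same []      = refl
⊕-same (x ∷ X) = cong₂ _∷_ (xor-same x) (⊕-same X)

⊕-cancelʳ : ∀ {n} (X Y : Subset n) → (X ⊕ Y) ⊕ Y ≡ X
⊕-cancelʳ X Y = trans (⊕-assoc X Y Y) (trans (cong (X ⊕_) (⊕-same Y)) (⊕-identityʳ X))

⊕≡∅⇒≡ : ∀ {n} (X Y : Subset n) → X ⊕ Y ≡ ∅ → X ≡ Y
⊕≡∅⇒≡ X Y eq = trans (sym (⊕-cancelʳ X Y))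
  (trans (cong (_⊕ Y) eq) (Vec.zipWith-identityˡ (λ _ → refl) Y))

⊕-⊆ : ∀ {n} {X Y Z : Subset n} → X ⊆ Z → Y ⊆ Z → X ⊕ Y ⊆ Z
⊕-⊆ {X = true ∷ X}  {false ∷ Y} X⊆Z Y⊆Z here        = X⊆Z here
⊕-⊆ {X = false ∷ X} {true ∷ Y}  X⊆Z Y⊆Z here        = Y⊆Z here
⊕-⊆ {X = x ∷ X}     {y ∷ Y} {z ∷ Z} X⊆Z Y⊆Z (there i∈) =
  there (⊕-⊆ (drop-∷-⊆ X⊆Z) (drop-∷-⊆ Y⊆Z) i∈)

∑-translate : ∀ {n} (f : Subset n → ℕ) Z → ∑ (λ X → f (X ⊕ Z)) ≡ ∑ f
∑-translate f []          = refl
∑-translate f (false ∷ Z) =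
  cong₂ _+_ (∑-translate (f ∘ (false ∷_)) Z) (∑-translate (f ∘ (true ∷_)) Z)
∑-translate f (true ∷ Z)  = trans
  (cong₂ _+_ (∑-translate (f ∘ (true ∷_)) Z) (∑-translate (f ∘ (false ∷_)) Z))
  (ℕ.+-comm (∑ (f ∘ (true ∷_))) _)

_·_ : ∀ {n} → Subset n → Subset n → Bool
[]      · []      = false
(x ∷ X) · (y ∷ Y) = (x ∧ y) xor X · Y

xor-exchange : ∀ a b c d → (a xor b) xor (c xor d) ≡ (a xor c) xor (b xor d)
xor-exchange a b c d = trans (xor-assoc a b (c xor d))
  (trans (cong (a xor_) (trans (sym (xor-assoc b c d))
    (trans (cong (_xor d) (xor-comm b c)) (xor-assoc c b d))))
  (sym (xor-assoc a c (b xor d))))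

·-⊕ : ∀ {n} (ρ X Y : Subset n) → ρ · (X ⊕ Y) ≡ ρ · X xor ρ · Y
·-⊕ []      []      []      = refl
·-⊕ (r ∷ ρ) (x ∷ X) (y ∷ Y) =
  trans (cong₂ _xor_ (∧-distribˡ-xor r x y) (·-⊕ ρ X Y)) (xor-exchange (r ∧ x) (r ∧ y) _ _)

-- M is the list of rows of a matrix.
_$ᴹ_ : ∀ {n r} → Vec (Subset n) r → Subset n → Subset r
M $ᴹ X = Vec.map (_· X) M

$ᴹ-⊕ : ∀ {n r} (M : Vec (Subset n) r) X Y → M $ᴹ (X ⊕ Y) ≡ M $ᴹ X ⊕ M $ᴹ Y
$ᴹ-⊕ []      X Y = refl
$ᴹ-⊕ (ρ ∷ M) X Y = cong₂ _∷_ (·-⊕ ρ X Y) ($ᴹ-⊕ M X Y)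

-- `M $ᴹ Y` is the sum of the columns of `M` indexed by `Y`, so this is linear independence of the
-- columns indexed by `X`.
Independent : ∀ {n r} → Vec (Subset n) r → Subset n → Set
Independent M X = ∀ {Y} → Y ⊆ X → M $ᴹ Y ≡ ∅ → Y ≡ ∅

record IsSubspace {n} (V : Subset n → Set) : Set where
  field
    ∅∈ : V ∅
    ⊕∈ : ∀ {X Y} → V X → V Y → V (X ⊕ Y)
open IsSubspace

⊆-subspace : ∀ {n} (X : Subset n) → IsSubspace (_⊆ X)
⊆-subspace X = record { ∅∈ = ⊥⊆ ; ⊕∈ = ⊕-⊆ }

-- `Independent M X` is the case `V = (_⊆ X)`. Elimination by rows replaces `V` by `V ∩ ρ ^⊥`, which
-- need not be of that form, hence the generality.
Trivial∩ker : ∀ {n r} → (Subset n → Set) → Vec (Subset n) r → Set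
Trivial∩ker V M = ∀ {Y} → V Y → M $ᴹ Y ≡ ∅ → Y ≡ ∅

_∩_^⊥ : ∀ {n} → (Subset n → Set) → Subset n → (Subset n → Set)
(V ∩ ρ ^⊥) Y = V Y × ρ · Y ≡ false

∩^⊥? : ∀ {n} {V : Subset n → Set} → (∀ Y → Dec (V Y)) → ∀ ρ Y → Dec ((V ∩ ρ ^⊥) Y)
∩^⊥? V? ρ Y = V? Y ×-dec (ρ · Y Bool.≟ false)

∩^⊥-subspace : ∀ {n} {V : Subset n → Set} → IsSubspace V → ∀ ρ → IsSubspace (V ∩ ρ ^⊥)
∩^⊥-subspace sub ρ = record
  { ∅∈ = ∅∈ sub , ·-∅ ρ
  ; ⊕∈ = λ {X} {Y} (VX , ρX) (VY , ρY) → ⊕∈ sub VX VY , trans (·-⊕ ρ X Y) (cong₂ _xor_ ρX ρY)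
  }
  where
  ·-∅ : ∀ {n} (ρ : Subset n) → ρ · ∅ ≡ false
  ·-∅ []      = refl
  ·-∅ (r ∷ ρ) = cong₂ _xor_ (∧-zeroʳ r) (·-∅ ρ)

pivot? : ∀ {n} {V : Subset n → Set} → (∀ Y → Dec (V Y)) → ∀ ρ →
         (∃ λ Y → V Y × ρ · Y ≡ true) ⊎ (∀ {Y} → V Y → ρ · Y ≡ false)
pivot? V? ρ with anySubset? (λ Y → V? Y ×-dec (ρ · Y Bool.≟ true))
... | yes p = inj₁ p
... | no ¬p = inj₂ λ {Y} VY → case ρ · Y Bool.≟ true of λ where
  (yes ρY) → contradiction (Y , VY , ρY) ¬p
  (no ρY)  → Bool.¬-not ρY

-- Translation by Z exchanges the two fibres of ρ on V.
card-∩^⊥ : ∀ {n} {V : Subset n → Set} (V? : ∀ Y → Dec (V Y)) → IsSubspace V → ∀ ρ {Z} →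
           V Z → ρ · Z ≡ true → ∑ (ind ∘ V?) ≤ 2 * ∑ (ind ∘ ∩^⊥? V? ρ)
card-∩^⊥ {V = V} V? sub ρ {Z} VZ ρZ = begin
  ∑ (ind ∘ V?)
    ≤⟨ ∑-mono split ⟩
  ∑ (λ Y → ind (V₀? Y) + ind (V₀? (Y ⊕ Z)))
    ≡⟨ ∑-+ (ind ∘ V₀?) _ ⟩
  ∑ (ind ∘ V₀?) + ∑ (λ Y → ind (V₀? (Y ⊕ Z)))
    ≡⟨ cong (∑ (ind ∘ V₀?) +_) (∑-translate (ind ∘ V₀?) Z) ⟩
  ∑ (ind ∘ V₀?) + ∑ (ind ∘ V₀?)
    ≡⟨ cong (∑ (ind ∘ V₀?) +_) (ℕ.+-identityʳ _) ⟨
  2 * ∑ (ind ∘ V₀?) ∎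
  where
  open ℕ.≤-Reasoning
  V₀? = ∩^⊥? V? ρ

  split : ∀ Y → ind (V? Y) ≤ ind (V₀? Y) + ind (V₀? (Y ⊕ Z))
  split Y with ρ · Y in ρY
  ... | false = ℕ.≤-trans
    (ind-mono (V? Y) (V? Y ×-dec (false Bool.≟ false)) (_, refl))
    (ℕ.m≤m+n _ _)
  ... | true  = ℕ.≤-trans
    (ind-mono (V? Y) (V₀? (Y ⊕ Z)) λ VY → ⊕∈ sub VY VZ , trans (·-⊕ ρ Y Z) (cong₂ _xor_ ρY ρZ))
    (ℕ.m≤n+m _ _)

trivial-∩^⊥ : ∀ {n r} {V : Subset n → Set} {ρ} {M : Vec (Subset n) r} →
              Trivial∩ker V (ρ ∷ M) → Trivial∩ker (V ∩ ρ ^⊥) M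
trivial-∩^⊥ triv (VY , ρY) MY = triv VY (cong₂ _∷_ ρY MY)

-- `M` is injective on `V`. Elimination avoids counting images: a row with a pivot halves `V`, and a
-- row vanishing on `V` can be deleted without enlarging the kernel on `V`.
card≤2^r : ∀ {n r} (M : Vec (Subset n) r) {V : Subset n → Set} (V? : ∀ Y → Dec (V Y)) →
           IsSubspace V → Trivial∩ker V M → ∑ (ind ∘ V?) ≤ 2 ^ r
card≤2^r {n} []     V? sub triv = ℕ.≤-trans
  (∑-mono λ Y → ind-mono (V? Y) (Y ≟ˢ ∅) λ VY → triv VY refl)
  (ℕ.≤-reflexive (∑-point {n} ∅))
card≤2^r (ρ ∷ M) V? sub triv with pivot? V? ρ
... | inj₁ (Z , VZ , ρZ) = ℕ.≤-trans (card-∩^⊥ V? sub ρ VZ ρZ)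
  (ℕ.*-monoʳ-≤ 2 (card≤2^r M (∩^⊥? V? ρ) (∩^⊥-subspace sub ρ) (trivial-∩^⊥ {ρ = ρ} triv)))
... | inj₂ ρV = ℕ.≤-trans
  (card≤2^r M V? sub λ VY MY → triv VY (cong₂ _∷_ (ρV VY) MY))
  (ℕ.m≤m+n _ _)

-- States that M(V) has codimension at most L: together with the image of an additive map from 𝔽₂^L
-- it generates 𝔽₂^r. The map may have a kernel, as it does for r = 0 < L.
record Complement {n r} (M : Vec (Subset n) r) (V : Subset n → Set) (L : ℕ) : Set where
  field
    embed   : Subset L → Subset r
    embed-⊕ : ∀ c d → embed (c ⊕ d) ≡ embed c ⊕ embed d
    cover   : ∀ w → ∃ λ Y → V Y × (∃ λ c → w ≡ M $ᴹ Y ⊕ embed c)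
open Complement

-- The size hypothesis is the codimension bound without dimensions. A pivot row halves both of its
-- sides and leaves L alone; a row vanishing on `V` contributes a coordinate that `embed` must fill,
-- at the cost of one unit of L.
complement : ∀ {n r} (M : Vec (Subset n) r) {V : Subset n → Set} (V? : ∀ Y → Dec (V Y)) →
             IsSubspace V → Trivial∩ker V M → ∀ L → 2 ^ r ≤ 2 ^ L * ∑ (ind ∘ V?) →
             Complement M V L
complement [] V? sub triv L _ = record
  { embed   = λ _ → []
  ; embed-⊕ = λ _ _ → refl
  ; cover   = λ { [] → ∅ , ∅∈ sub , ∅ , refl }
  }
complement (ρ ∷ M) {V} V? sub triv L large with pivot? V? ρ
complement (ρ ∷ M) {V} V? sub triv L large | inj₁ (Z , VZ , ρZ) = record
  { embed   = λ c → false ∷ embed IH c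
  ; embed-⊕ = λ c d → cong (false ∷_) (embed-⊕ IH c d)
  ; cover   = λ
    { (false ∷ w) → let Y , (VY , ρY) , c , eq = cover IH w in
        Y , VY , c , cong₂ _∷_ (sym (trans (xor-identityʳ _) ρY)) eq
    -- Vectors of `V ∩ ρ ^⊥` have first coordinate `false`. Adding the pivot `Z` corrects it, and
    -- the shift of the target by `M $ᴹ Z` compensates in the other rows.
    ; (true ∷ w)  → let Y , (VY , ρY) , c , eq = cover IH (w ⊕ M $ᴹ Z) in
        Y ⊕ Z , ⊕∈ sub VY VZ , c ,
        cong₂ _∷_ (sym (trans (xor-identityʳ _) (trans (·-⊕ ρ Y Z) (cong₂ _xor_ ρY ρZ))))
                  (add Y eq)
    }
  }
  where
  IH : Complement M (V ∩ ρ ^⊥) L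
  IH = complement M (∩^⊥? V? ρ) (∩^⊥-subspace sub ρ) (trivial-∩^⊥ {ρ = ρ} triv) L
    (ℕ.*-cancelˡ-≤ 2 (ℕ.≤-trans large
      (ℕ.≤-trans (ℕ.*-monoʳ-≤ (2 ^ L) (card-∩^⊥ V? sub ρ VZ ρZ))
                 (ℕ.≤-reflexive (comm (2 ^ L) _)))))
    where
    comm : ∀ a b → a * (2 * b) ≡ 2 * (a * b)
    comm = solve-∀

  add : ∀ {w u} Y → w ⊕ M $ᴹ Z ≡ M $ᴹ Y ⊕ u → w ≡ M $ᴹ (Y ⊕ Z) ⊕ u
  add {w} {u} Y eq = begin
    w                           ≡⟨ ⊕-cancelʳ w (M $ᴹ Z) ⟨
    (w ⊕ M $ᴹ Z) ⊕ M $ᴹ Z       ≡⟨ cong (_⊕ M $ᴹ Z) eq ⟩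
    (M $ᴹ Y ⊕ u) ⊕ M $ᴹ Z       ≡⟨ ⊕-assoc (M $ᴹ Y) u (M $ᴹ Z) ⟩
    M $ᴹ Y ⊕ (u ⊕ M $ᴹ Z)       ≡⟨ cong (M $ᴹ Y ⊕_) (⊕-comm u (M $ᴹ Z)) ⟩
    M $ᴹ Y ⊕ (M $ᴹ Z ⊕ u)       ≡⟨ ⊕-assoc (M $ᴹ Y) (M $ᴹ Z) u ⟨
    (M $ᴹ Y ⊕ M $ᴹ Z) ⊕ u       ≡⟨ cong (_⊕ u) ($ᴹ-⊕ M Y Z) ⟨
    M $ᴹ (Y ⊕ Z) ⊕ u            ∎
    where open ≡-Reasoning
-- With no unit of L left, `V` has at least 2^(r+1) elements, yet the r remaining rows already
-- separate them.
complement {r = suc r} (ρ ∷ M) {V} V? sub triv zero large | inj₂ ρV =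
  contradiction (ℕ.≤-trans large (ℕ.≤-trans (ℕ.≤-reflexive (ℕ.*-identityˡ _)) small))
                (ℕ.<⇒≱ (ℕ.^-monoʳ-< 2 (s≤s (s≤s z≤n)) (ℕ.n<1+n r)))
  where
  small : ∑ (ind ∘ V?) ≤ 2 ^ r
  small = card≤2^r M V? sub λ VY MY → triv VY (cong₂ _∷_ (ρV VY) MY)
complement (ρ ∷ M) {V} V? sub triv (suc L) large | inj₂ ρV = record
  { embed   = λ { (b ∷ c) → b ∷ embed IH c }
  ; embed-⊕ = λ { (a ∷ c) (b ∷ d) → cong ((a xor b) ∷_) (embed-⊕ IH c d) }
  ; cover   = λ { (b ∷ w) → let Y , VY , c , eq = cover IH w in
      Y , VY , b ∷ c , cong₂ _∷_ (cong (_xor b) (sym (ρV VY))) eq }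
  }
  where
  IH : Complement M V L
  IH = complement M V? sub (λ VY MY → triv VY (cong₂ _∷_ (ρV VY) MY)) L
    (ℕ.*-cancelˡ-≤ 2 (ℕ.≤-trans large (ℕ.≤-reflexive (ℕ.*-assoc 2 (2 ^ L) _))))

-- A subspace of 𝔽₂^L is recorded by an element with nonzero first coordinate, if there is
-- one, together with its intersection with the hyperplane where that coordinate vanishes.

codeLength : ℕ → ℕ
codeLength zero    = 0
codeLength (suc L) = suc L + codeLength L

-- The exact length is 1 + 2 + ... + L = L(L+1)/2; the weaker square gives the exponent in m.
codeLength≤ : ∀ L → codeLength L ≤ L ^ 2
codeLength≤ zero    = z≤n
codeLength≤ (suc L) = ℕ.≤-trans (ℕ.+-monoʳ-≤ (suc L) (codeLength≤ L))
  (ℕ.≤-trans (ℕ.m≤m+n _ L) (ℕ.≤-reflexive (square L)))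
  where
  square : ∀ L → suc L + L * (L * 1) + L ≡ suc L * (suc L * 1)
  square = solve-∀

leading : ∀ {L} {S : Subset (suc L) → Set} → (∀ c → Dec (S c)) → Subset (suc L)
leading S? with anySubset? (S? ∘ (true ∷_))
... | yes (c , _) = true ∷ c
-- `∅` lies in every subspace, so `leading-∈` holds in this case too.
... | no  _       = ∅

code : ∀ {L} {S : Subset L → Set} → (∀ c → Dec (S c)) → Subset (codeLength L)
code {zero}  S? = []
code {suc L} S? = leading S? Vec.++ code (S? ∘ (false ∷_))

slice-subspace : ∀ {L} {S : Subset (suc L) → Set} → IsSubspace S → IsSubspace (S ∘ (false ∷_))
slice-subspace sub = record { ∅∈ = ∅∈ sub ; ⊕∈ = ⊕∈ sub }

leading-∈ : ∀ {L} {S : Subset (suc L) → Set} (S? : ∀ c → Dec (S c)) → IsSubspace S →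
            S (leading S?)
leading-∈ S? sub with anySubset? (S? ∘ (true ∷_))
... | yes (_ , Sc) = Sc
... | no  _        = ∅∈ sub

leading-true : ∀ {L} {S : Subset (suc L) → Set} (S? : ∀ c → Dec (S c)) {c} → S (true ∷ c) →
               ∃ λ d → leading S? ≡ true ∷ d
leading-true S? Sc with anySubset? (S? ∘ (true ∷_))
... | yes (d , _) = d , refl
... | no ¬S       = contradiction (_ , Sc) ¬S

-- A vector of S outside the hyperplane is moved into it by adding the leading vector, which S and T
-- share; there induction applies, and adding the leading vector again returns to the original
-- vector, now in T.
code-injective : ∀ {L} {S T : Subset L → Set} (S? : ∀ c → Dec (S c)) (T? : ∀ c → Dec (T c)) →
                 IsSubspace S → IsSubspace T → code S? ≡ code T? → ∀ c → S c → T c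
code-injective {zero}  S? T? subS subT eq [] _ = ∅∈ subT
code-injective {suc L} {S} {T} S? T? subS subT eq = step
  where
  eqs : leading S? ≡ leading T? × code (S? ∘ (false ∷_)) ≡ code (T? ∘ (false ∷_))
  eqs = Vec.++-injective (leading S?) (leading T?) eq

  IH : ∀ c → S (false ∷ c) → T (false ∷ c)
  IH = code-injective (S? ∘ (false ∷_)) (T? ∘ (false ∷_))
         (slice-subspace subS) (slice-subspace subT) (proj₂ eqs)

  step : ∀ c → S c → T c
  step (false ∷ c) Sc = IH c Sc
  step (true ∷ c)  Sc with leading-true S? Sc
  ... | d , lead≡ = subst T (⊕-cancelʳ (true ∷ c) (true ∷ d)) (⊕∈ subT T-sum T-lead)
    where
    S-lead : S (true ∷ d)
    S-lead = subst S lead≡ (leading-∈ S? subS)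

    T-lead : T (true ∷ d)
    T-lead = subst T (trans (sym (proj₁ eqs)) lead≡) (leading-∈ T? subT)

    T-sum : T (false ∷ c ⊕ d)
    T-sum = IH (c ⊕ d) (⊕∈ subS Sc S-lead)

bit : Bool → Fin 2
bit b = if b then suc zero else zero

bit-injective : ∀ x y → bit x ≡ bit y → x ≡ y
bit-injective false false _ = refl
bit-injective true  true  _ = refl

toFin : ∀ {n} → Subset n → Fin (2 ^ n)
toFin []      = zero
toFin (x ∷ X) = combine (bit x) (toFin X)

toFin-injective : ∀ {n} (X Y : Subset n) → toFin X ≡ toFin Y → X ≡ Y
toFin-injective []      []      _  = refl
toFin-injective (x ∷ X) (y ∷ Y) eq with combine-injective (bit x) (toFin X) (bit y) (toFin Y) eq
... | eq₁ , eq₂ = cong₂ _∷_ (bit-injective x y eq₁) (toFin-injective X Y eq₂)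

-- As embed and the span of A generate the whole space, the span W of B i ⊇ A is determined by its
-- preimage S i under embed, a subspace of 𝔽₂^L.
no-large-star : ∀ {n r} L (M : Vec (Subset n) r) {m} → 2 ^ (L ^ 2) < m →
  (A : Subset n) → r ≤ L + ∥ A ∥ → (B : Fin m → Subset n) → (∀ i → A ⊆ B i) →
  (∀ i j → ∃ λ D → B i ⊆ D × B j ⊆ D × Independent M D) →
  ∃ λ i → ∃ λ j → i ≢ j × B i ≡ B j
-- The match exhibits `m` as a successor. The index `zero` then gives an independent set containing
-- `B zero`, hence `A`.
no-large-star {n} {r} L M m> A r≤ B A⊆B ind∪ with m>
... | s≤s _ = i , j , <⇒≢ i<j ,
              ⊆-antisym (transfer i j (S⇒S i j code≡)) (transfer j i (S⇒S j i (sym code≡)))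
  where
  compl : Complement M (_⊆ A) L
  compl = complement M (_⊆? A) (⊆-subspace A)
    (λ Y⊆A → let _ , B⊆D , _ , indep = ind∪ zero zero in
      indep (⊆-trans Y⊆A (⊆-trans (A⊆B zero) B⊆D)))
    L
    (subst (λ k → 2 ^ r ≤ 2 ^ L * k) (sym (∑-⊆ A))
      (subst (2 ^ r ≤_) (ℕ.^-distribˡ-+-* 2 L ∥ A ∥) (ℕ.^-monoʳ-≤ 2 r≤)))

  S : Fin _ → Subset L → Set
  S i c = ∃ λ Y → Y ⊆ B i × M $ᴹ Y ≡ embed compl c

  S? : ∀ i c → Dec (S i c)
  S? i c = anySubset? λ Y → (Y ⊆? B i) ×-dec (M $ᴹ Y ≟ˢ embed compl c)

  subspace : ∀ i → IsSubspace (S i)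
  subspace i = record
    { ∅∈ = ∅ , ⊥⊆ , trans (additive-∅ M∅) (sym (additive-∅ embed∅))
    ; ⊕∈ = λ { {c} {d} (Y , Y⊆ , eq) (Z , Z⊆ , eq′) →
        Y ⊕ Z , ⊕-⊆ Y⊆ Z⊆ ,
        trans ($ᴹ-⊕ M Y Z) (trans (cong₂ _⊕_ eq eq′) (sym (embed-⊕ compl c d))) }
    }
    where
    additive-∅ : ∀ {k} {w : Subset k} → w ≡ w ⊕ w → w ≡ ∅
    additive-∅ {w = w} eq = trans eq (⊕-same w)

    M∅ : M $ᴹ ∅ ≡ M $ᴹ ∅ ⊕ M $ᴹ ∅
    M∅ = trans (cong (M $ᴹ_) (sym (⊕-same ∅))) ($ᴹ-⊕ M ∅ ∅)

    embed∅ : embed compl ∅ ≡ embed compl ∅ ⊕ embed compl ∅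
    embed∅ = trans (cong (embed compl) (sym (⊕-same ∅))) (embed-⊕ compl ∅ ∅)

  collision = pigeonhole
    (ℕ.≤-<-trans (ℕ.^-monoʳ-≤ 2 (codeLength≤ L)) m>) (λ i → toFin (code (S? i)))
  i = proj₁ collision
  j = proj₁ (proj₂ collision)
  i<j = proj₁ (proj₂ (proj₂ collision))

  code≡ : code (S? i) ≡ code (S? j)
  code≡ = toFin-injective _ _ (proj₂ (proj₂ (proj₂ collision)))

  S⇒S : ∀ i j → code (S? i) ≡ code (S? j) → ∀ c → S i c → S j c
  S⇒S i j = code-injective (S? i) (S? j) (subspace i) (subspace j)

  -- Only the vector `B i` itself is tested. Modulo the span of `A` its image is some
  -- `embed compl c`; as c also lies in `S j`, `B i` has the same image as `Y ⊕ Z` with `Y ⊆ A` and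
  -- `Z ⊆ B j`. Independence of a set containing `B i` and `B j` makes the two vectors equal.
  transfer : ∀ i j → (∀ c → S i c → S j c) → B i ⊆ B j
  transfer i j Si⇒Sj with cover compl (M $ᴹ B i)
  ... | Y , Y⊆A , c , eq with Si⇒Sj c (B i ⊕ Y , ⊕-⊆ ⊆-refl (⊆-trans Y⊆A (A⊆B i)) , eq′)
    where
    eq′ : M $ᴹ (B i ⊕ Y) ≡ embed compl c
    eq′ = trans ($ᴹ-⊕ M (B i) Y) (trans (cong (_⊕ M $ᴹ Y) (trans eq (⊕-comm (M $ᴹ Y) _)))
                                        (⊕-cancelʳ (embed compl c) (M $ᴹ Y)))
  ... | Z , Z⊆B , eqZ with ind∪ i j
  ... | D , Bi⊆D , Bj⊆D , indep = subst (_⊆ B j) (sym Bi≡) YZ⊆B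
    where
    YZ⊆B : Y ⊕ Z ⊆ B j
    YZ⊆B = ⊕-⊆ (⊆-trans Y⊆A (A⊆B j)) Z⊆B

    Bi≡ : B i ≡ Y ⊕ Z
    Bi≡ = ⊕≡∅⇒≡ (B i) (Y ⊕ Z) (indep (⊕-⊆ Bi⊆D (⊆-trans YZ⊆B Bj⊆D))
      (trans ($ᴹ-⊕ M (B i) (Y ⊕ Z)) (trans
        (cong₂ _⊕_ eq (trans ($ᴹ-⊕ M Y Z) (cong (M $ᴹ Y ⊕_) eqZ)))
        (⊕-same _))))

-- Averaging

-- At a coordinate belonging to `Y`, flipping that coordinate of ρ flips `ρ · Y`.
orthogonal-half : ∀ {n} (Y : Subset n) → Y ≢ ∅ →
                  2 * ∑ (λ ρ → ind (ρ · Y Bool.≟ false)) ≡ 2 ^ n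
orthogonal-half []              Y≢∅ = contradiction refl Y≢∅
orthogonal-half {suc n} (false ∷ Y) Y≢∅ = cong (2 *_) (trans
  (cong (∑ {n} (λ ρ → ind (ρ · Y Bool.≟ false)) +_) (sym (ℕ.+-identityʳ _)))
  (orthogonal-half Y (Y≢∅ ∘ cong (false ∷_))))
orthogonal-half {suc n} (true ∷ Y) Y≢∅ = cong (2 *_) (trans
  (sym (∑-+ {n} (λ ρ → ind (ρ · Y Bool.≟ false)) _))
  (trans (∑-cong {n} (λ ρ → complementary (ρ · Y))) (trans (∑-const n 1) (ℕ.*-identityʳ (2 ^ n)))))
  where
  complementary : ∀ b → ind (b Bool.≟ false) + ind ((true xor b) Bool.≟ false) ≡ 1
  complementary false = refl
  complementary true  = refl

-- Averaged over ρ, each nonempty `Y` keeps exactly half of its weight. `∅` is orthogonal to every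
-- row, so it must carry none.
halving-row : ∀ {n} (w : Subset n → ℕ) → w ∅ ≡ 0 →
              ∃ λ ρ → 2 * ∑ (λ Y → ind (ρ · Y Bool.≟ false) * w Y) ≤ ∑ w
halving-row {n} w w∅ with ∑-min (λ ρ → ∑ (λ Y → ind (ρ · Y Bool.≟ false) * w Y))
... | ρ , min = ρ , ℕ.*-cancelˡ-≤ (2 ^ n) {{ℕ.m^n≢0 2 n}} (begin
  2 ^ n * (2 * g ρ)                             ≡⟨ comm (2 ^ n) 2 (g ρ) ⟩
  2 * (2 ^ n * g ρ)                             ≤⟨ ℕ.*-monoʳ-≤ 2 min ⟩
  2 * ∑ g                                       ≡⟨ cong (2 *_) (∑-swap (λ ρ Y → χ ρ Y * w Y)) ⟩
  2 * ∑ (λ Y → ∑ (λ ρ → χ ρ Y * w Y))           ≡⟨ ∑-*ˡ 2 (λ Y → ∑ (λ ρ → χ ρ Y * w Y)) ⟨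
  ∑ (λ Y → 2 * ∑ (λ ρ → χ ρ Y * w Y))           ≡⟨ ∑-cong row ⟩
  ∑ (λ Y → 2 ^ n * w Y)                         ≡⟨ ∑-*ˡ (2 ^ n) w ⟩
  2 ^ n * ∑ w                                   ∎)
  where
  open ℕ.≤-Reasoning
  χ : Subset n → Subset n → ℕ
  χ ρ Y = ind (ρ · Y Bool.≟ false)

  g : Subset n → ℕ
  g ρ = ∑ (λ Y → χ ρ Y * w Y)

  comm : ∀ a b c → a * (b * c) ≡ b * (a * c)
  comm = solve-∀

  row : ∀ Y → 2 * ∑ (λ ρ → χ ρ Y * w Y) ≡ 2 ^ n * w Y
  row Y = begin-equality
    2 * ∑ (λ ρ → χ ρ Y * w Y) ≡⟨ cong (2 *_) (∑-cong λ ρ → ℕ.*-comm (χ ρ Y) (w Y)) ⟩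
    2 * ∑ (λ ρ → w Y * χ ρ Y) ≡⟨ cong (2 *_) (∑-*ˡ (w Y) (λ ρ → χ ρ Y)) ⟩
    2 * (w Y * ∑ (λ ρ → χ ρ Y)) ≡⟨ comm 2 (w Y) _ ⟩
    w Y * (2 * ∑ (λ ρ → χ ρ Y)) ≡⟨ weighted (Y ≟ˢ ∅) ⟩
    w Y * 2 ^ n               ≡⟨ ℕ.*-comm (w Y) (2 ^ n) ⟩
    2 ^ n * w Y               ∎
    where
    weighted : Dec (Y ≡ ∅) → w Y * (2 * ∑ (λ ρ → χ ρ Y)) ≡ w Y * 2 ^ n
    weighted (yes refl) rewrite w∅ = refl
    weighted (no Y≢∅) = cong (w Y *_) (orthogonal-half Y Y≢∅)

-- The method of conditional expectations: each row is chosen for the weight that survives the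
-- earlier rows, so no sum over matrices is formed.
small-kernel : ∀ {n} r (w : Subset n → ℕ) → w ∅ ≡ 0 →
               ∃ λ (M : Vec (Subset n) r) → 2 ^ r * ∑ (λ Y → ind (M $ᴹ Y ≟ˢ ∅) * w Y) ≤ ∑ w
small-kernel zero    w w∅ = [] ,
  ℕ.≤-reflexive (trans (ℕ.*-identityˡ _) (∑-cong λ Y → ℕ.*-identityˡ (w Y)))
small-kernel (suc r) w w∅ with halving-row w w∅
... | ρ , half with small-kernel r w′ (trans (cong (χ ∅ *_) w∅) (ℕ.*-zeroʳ (χ ∅)))
  where
  χ : Subset _ → ℕ
  χ Y = ind (ρ · Y Bool.≟ false)

  w′ : Subset _ → ℕ
  w′ Y = χ Y * w Y
... | M , small = ρ ∷ M , (begin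
  2 * 2 ^ r * ∑ (λ Y → ind ((ρ ∷ M) $ᴹ Y ≟ˢ ∅) * w Y)
    ≤⟨ ℕ.*-monoʳ-≤ (2 * 2 ^ r) (∑-mono split) ⟩
  2 * 2 ^ r * ∑ (λ Y → ind (M $ᴹ Y ≟ˢ ∅) * (ind (ρ · Y Bool.≟ false) * w Y))
    ≡⟨ ℕ.*-assoc 2 (2 ^ r) _ ⟩
  2 * (2 ^ r * ∑ (λ Y → ind (M $ᴹ Y ≟ˢ ∅) * (ind (ρ · Y Bool.≟ false) * w Y)))
    ≤⟨ ℕ.*-monoʳ-≤ 2 small ⟩
  2 * ∑ (λ Y → ind (ρ · Y Bool.≟ false) * w Y)
    ≤⟨ half ⟩
  ∑ w ∎)
  where
  open ℕ.≤-Reasoning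
  split : ∀ Y → ind ((ρ ∷ M) $ᴹ Y ≟ˢ ∅) * w Y ≤
                ind (M $ᴹ Y ≟ˢ ∅) * (ind (ρ · Y Bool.≟ false) * w Y)
  split Y = begin
    ind ((ρ ∷ M) $ᴹ Y ≟ˢ ∅) * w Y
      ≤⟨ ℕ.*-monoˡ-≤ (w Y) (ind-mono ((ρ ∷ M) $ᴹ Y ≟ˢ ∅) (M0? ×-dec ρ0?)
           λ eq → Vec.∷-injectiveʳ eq , Vec.∷-injectiveˡ eq) ⟩
    ind (M0? ×-dec ρ0?) * w Y  ≡⟨ cong (_* w Y) (ind-× M0? ρ0?) ⟩
    ind M0? * ind ρ0? * w Y    ≡⟨ ℕ.*-assoc (ind M0?) (ind ρ0?) (w Y) ⟩
    ind M0? * (ind ρ0? * w Y)  ∎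
    where
    M0? = M $ᴹ Y ≟ˢ ∅
    ρ0? = ρ · Y Bool.≟ false

-- A searchable witness of dependence, so that dependent sets can be decided and counted.
Dependent : ∀ {n r} → Vec (Subset n) r → Subset n → Set
Dependent M X = ∃ λ Y → (Y ⊆ X × Y ≢ ∅) × M $ᴹ Y ≡ ∅

dependent? : ∀ {n r} (M : Vec (Subset n) r) X → Dec (Dependent M X)
dependent? M X = anySubset? λ Y → ((Y ⊆? X) ×-dec ¬? (Y ≟ˢ ∅)) ×-dec (M $ᴹ Y ≟ˢ ∅)

¬dependent⇒independent : ∀ {n r} (M : Vec (Subset n) r) {X} → ¬ Dependent M X → Independent M X
¬dependent⇒independent M ¬dep {Y} Y⊆X MY =
  decidable-stable (Y ≟ˢ ∅) λ Y≢∅ → ¬dep (Y , (Y⊆X , Y≢∅) , MY)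

-- Each nonempty Y ⊆ X is killed by a random matrix with probability 2^-r, so a set X with
-- |X| < r is dependent with probability at most 1/2.
mostly-independent : ∀ {n} r {Q : Subset n → Set} (Q? : ∀ X → Dec (Q X)) →
  (∀ {X} → Q X → ∥ X ∥ < r) →
  ∃ λ (M : Vec (Subset n) r) →
    ∑ (ind ∘ Q?) ≤ 2 * ∑ (λ X → ind (Q? X ×-dec ¬? (dependent? M X)))
mostly-independent {n} r {Q} Q? short = M , ℕ.+-cancelʳ-≤ (∑ q) _ _ (begin
  ∑ q + ∑ q               ≡⟨ double (∑ q) ⟩
  2 * ∑ q                 ≤⟨ ℕ.*-monoʳ-≤ 2 total ⟩
  2 * (∑ good + ∑ bad)    ≡⟨ ℕ.*-distribˡ-+ 2 (∑ good) _ ⟩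
  2 * ∑ good + 2 * ∑ bad  ≤⟨ ℕ.+-monoʳ-≤ (2 * ∑ good) few ⟩
  2 * ∑ good + ∑ q        ∎)
  where
  open ℕ.≤-Reasoning

  double : ∀ a → a + a ≡ 2 * a
  double = solve-∀

  q : Subset n → ℕ
  q = ind ∘ Q?

  sub? : ∀ X Y → Dec (Y ⊆ X × Y ≢ ∅)
  sub? X Y = (Y ⊆? X) ×-dec ¬? (Y ≟ˢ ∅)

  -- `w Y` counts the sets in which `Y` could be a dependence. Summed over the kernel of a matrix it
  -- bounds the number of dependent sets: the union bound.
  w : Subset n → ℕ
  w Y = ∑ (λ X → ind (Q? X ×-dec sub? X Y))

  w∅ : w ∅ ≡ 0
  w∅ = ∑-zero (λ X → Q? X ×-dec sub? X ∅) λ { X (_ , _ , ∅≢∅) → ∅≢∅ refl }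

  kernel : ∃ λ (M : Vec (Subset n) r) → 2 ^ r * ∑ (λ Y → ind (M $ᴹ Y ≟ˢ ∅) * w Y) ≤ ∑ w
  kernel = small-kernel r w w∅

  M = proj₁ kernel

  κ : Subset n → ℕ
  κ Y = ind (M $ᴹ Y ≟ˢ ∅)

  good bad : Subset n → ℕ
  good X = ind (Q? X ×-dec ¬? (dependent? M X))
  bad X  = ind (Q? X ×-dec dependent? M X)

  total : ∑ q ≤ ∑ good + ∑ bad
  total = ℕ.≤-trans (∑-mono split) (ℕ.≤-reflexive (∑-+ good bad))
    where
    split : ∀ X → q X ≤ good X + bad X
    split X with Q? X | dependent? M X
    ... | yes _ | yes _ = ℕ.≤-refl
    ... | yes _ | no _  = ℕ.≤-refl
    ... | no _  | _     = z≤n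

  bad≤ : ∀ X → bad X ≤ ∑ (λ Y → κ Y * ind (Q? X ×-dec sub? X Y))
  bad≤ X = helper (Q? X ×-dec dependent? M X)
    where
    helper : (d : Dec (Q X × Dependent M X)) →
             ind d ≤ ∑ (λ Y → κ Y * ind (Q? X ×-dec sub? X Y))
    helper (no _)                   = z≤n
    helper (yes (QX , Y , sub , MY)) = ℕ.≤-trans
      (ℕ.≤-reflexive (sym (cong₂ _*_ (ind-yes (M $ᴹ Y ≟ˢ ∅) MY)
                                     (ind-yes (Q? X ×-dec sub? X Y) (QX , sub)))))
      (f≤∑f (λ Y → κ Y * ind (Q? X ×-dec sub? X Y)) Y)

  ∑bad≤ : ∑ bad ≤ ∑ (λ Y → κ Y * w Y)
  ∑bad≤ = begin
    ∑ bad
      ≤⟨ ∑-mono bad≤ ⟩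
    ∑ (λ X → ∑ (λ Y → κ Y * ind (Q? X ×-dec sub? X Y)))
      ≡⟨ ∑-swap (λ X Y → κ Y * ind (Q? X ×-dec sub? X Y)) ⟩
    ∑ (λ Y → ∑ (λ X → κ Y * ind (Q? X ×-dec sub? X Y)))
      ≡⟨ ∑-cong (λ Y → ∑-*ˡ (κ Y) (λ X → ind (Q? X ×-dec sub? X Y))) ⟩
    ∑ (λ Y → κ Y * w Y) ∎

  -- At most 2^|X| candidates lie in X, and the strict inequality |X| < r pays for the factor 2.
  weight : ∀ X → 2 * ∑ (λ Y → ind (Q? X ×-dec sub? X Y)) ≤ 2 ^ r * q X
  weight X = begin
    2 * ∑ (λ Y → ind (Q? X ×-dec sub? X Y))
      ≤⟨ ℕ.*-monoʳ-≤ 2 (∑-mono λ Y → ind-mono (Q? X ×-dec sub? X Y) (Q? X ×-dec (Y ⊆? X))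
           λ (QX , Y⊆X , _) → QX , Y⊆X) ⟩
    2 * ∑ (λ Y → ind (Q? X ×-dec (Y ⊆? X)))
      ≡⟨ cong (2 *_) (∑-cong λ Y → ind-× (Q? X) (Y ⊆? X)) ⟩
    2 * ∑ (λ Y → q X * ind (Y ⊆? X))
      ≡⟨ cong (2 *_) (∑-*ˡ (q X) (λ Y → ind (Y ⊆? X))) ⟩
    2 * (q X * ∑ (λ Y → ind (Y ⊆? X)))
      ≡⟨ cong (λ k → 2 * (q X * k)) (∑-⊆ X) ⟩
    2 * (q X * 2 ^ ∥ X ∥)
      ≤⟨ bounded (Q? X) ⟩
    2 ^ r * q X ∎
    where
    bounded : (d : Dec (Q X)) → 2 * (ind d * 2 ^ ∥ X ∥) ≤ 2 ^ r * ind d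
    bounded (no _)   = z≤n
    bounded (yes QX) = begin
      2 * (2 ^ ∥ X ∥ + 0) ≡⟨ cong (2 *_) (ℕ.+-identityʳ (2 ^ ∥ X ∥)) ⟩
      2 ^ suc ∥ X ∥       ≤⟨ ℕ.^-monoʳ-≤ 2 (short QX) ⟩
      2 ^ r               ≡⟨ ℕ.*-identityʳ _ ⟨
      2 ^ r * 1           ∎

  few : 2 * ∑ bad ≤ ∑ q
  few = ℕ.*-cancelˡ-≤ (2 ^ r) {{ℕ.m^n≢0 2 r}} (begin
    2 ^ r * (2 * ∑ bad)
      ≡⟨ comm (2 ^ r) 2 _ ⟩
    2 * (2 ^ r * ∑ bad)
      ≤⟨ ℕ.*-monoʳ-≤ 2 (ℕ.*-monoʳ-≤ (2 ^ r) ∑bad≤) ⟩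
    2 * (2 ^ r * ∑ (λ Y → κ Y * w Y))
      ≤⟨ ℕ.*-monoʳ-≤ 2 (proj₂ kernel) ⟩
    2 * ∑ w
      ≡⟨ cong (2 *_) (∑-swap (λ Y X → ind (Q? X ×-dec sub? X Y))) ⟩
    2 * ∑ (λ X → ∑ (λ Y → ind (Q? X ×-dec sub? X Y)))
      ≡⟨ ∑-*ˡ 2 (λ X → ∑ (λ Y → ind (Q? X ×-dec sub? X Y))) ⟨
    ∑ (λ X → 2 * ∑ (λ Y → ind (Q? X ×-dec sub? X Y)))
      ≤⟨ ∑-mono weight ⟩
    ∑ (λ X → 2 ^ r * q X)
      ≡⟨ ∑-*ˡ (2 ^ r) q ⟩
    2 ^ r * ∑ q ∎)
    where
    comm : ∀ a b c → a * (b * c) ≡ b * (a * c)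
    comm = solve-∀

-- Families

collect : ∀ {n} {P : Subset n → Set} → (∀ X → Dec (P X)) → List (Subset n)
collect {zero}  P? = if does (P? []) then [] List.∷ List.[] else List.[]
collect {suc n} P? = List.map (false ∷_) (collect (P? ∘ (false ∷_))) ++
                     List.map (true ∷_) (collect (P? ∘ (true ∷_)))

length-collect : ∀ {n} {P : Subset n → Set} (P? : ∀ X → Dec (P X)) →
                 length (collect P?) ≡ ∑ (ind ∘ P?)
length-collect {zero} P? with P? []
... | yes _ = refl
... | no  _ = refl
length-collect {suc n} P? = trans (List.length-++ (List.map (false ∷_) (collect (P? ∘ (false ∷_)))))
  (cong₂ _+_
    (trans (List.length-map (false ∷_) (collect (P? ∘ (false ∷_))))
           (length-collect (P? ∘ (false ∷_))))
    (trans (List.length-map (true ∷_) (collect (P? ∘ (true ∷_))))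
           (length-collect (P? ∘ (true ∷_)))))

collect-unique : ∀ {n} {P : Subset n → Set} (P? : ∀ X → Dec (P X)) → Unique (collect P?)
collect-unique {zero} P? with P? []
... | yes _ = All.[] AllPairs.∷ AllPairs.[]
... | no  _ = AllPairs.[]
collect-unique {suc n} P? = Unique.++⁺
  (Unique.map⁺ Vec.∷-injectiveʳ (collect-unique (P? ∘ (false ∷_))))
  (Unique.map⁺ Vec.∷-injectiveʳ (collect-unique (P? ∘ (true ∷_))))
  disjoint
  where
  disjoint : ∀ {X} → ¬ (X ∈ List.map (false ∷_) (collect (P? ∘ (false ∷_))) ×
                        X ∈ List.map (true ∷_) (collect (P? ∘ (true ∷_))))
  disjoint (p , q) with ∈-map⁻ (false ∷_) p | ∈-map⁻ (true ∷_) q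
  ... | _ , _ , refl | _ , _ , ()

collect-∈ : ∀ {n} {P : Subset n → Set} (P? : ∀ X → Dec (P X)) {X} →
            X ∈ collect P? → P X
collect-∈ {zero} P? X∈ with P? [] | X∈
... | yes P[] | Any.here refl = P[]
collect-∈ {suc n} P? X∈ with ∈-++⁻ (List.map (false ∷_) (collect (P? ∘ (false ∷_)))) X∈
... | inj₁ p with ∈-map⁻ (false ∷_) p
...   | _ , Y∈ , refl = collect-∈ (P? ∘ (false ∷_)) Y∈
collect-∈ {suc n} P? X∈ | inj₂ q with ∈-map⁻ (true ∷_) q
...   | _ , Y∈ , refl = collect-∈ (P? ∘ (true ∷_)) Y∈

comprehension : ∀ {n} {P : Subset n → Set} → (∀ X → Dec (P X)) → Family n
comprehension P? = family (collect P?) (collect-unique P?)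

∥X∪Y∥≤ : ∀ {n} (X Y : Subset n) → ∥ X ∪ Y ∥ ≤ ∥ X ∥ + ∥ Y ∥
∥X∪Y∥≤ []          []          = z≤n
∥X∪Y∥≤ (false ∷ X) (false ∷ Y) = ∥X∪Y∥≤ X Y
∥X∪Y∥≤ (false ∷ X) (true ∷ Y)  =
  ℕ.≤-trans (s≤s (∥X∪Y∥≤ X Y)) (ℕ.≤-reflexive (sym (ℕ.+-suc ∥ X ∥ ∥ Y ∥)))
∥X∪Y∥≤ (true ∷ X)  (false ∷ Y) = s≤s (∥X∪Y∥≤ X Y)
∥X∪Y∥≤ (true ∷ X)  (true ∷ Y)  =
  s≤s (ℕ.≤-trans (∥X∪Y∥≤ X Y) (ℕ.+-monoʳ-≤ ∥ X ∥ (ℕ.n≤1+n ∥ Y ∥)))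

-- The size bound is applied to the image of the bottom element, independence to the images of the
-- pairs. Two singletons with the same image then contradict injectivity.
independent-free : ∀ {n r} L (M : Vec (Subset n) r) {m} → 2 ^ (L ^ 2) < m → (𝓕 : Family n) →
  (∀ {X} → X ∈ᶠ 𝓕 → r ≤ L + ∥ X ∥ × Independent M X) → Free S₂[ m ,0] 𝓕
independent-free L M {m} m> 𝓕 prop (𝓖 , 𝓖⊆𝓕 , w) =
  let i , j , i≢j , eq = no-large-star L M m> A (proj₁ (at empty)) B (λ i → monotone ⊥⊆) pairs
  in i≢j (x∈⁅y⁆⇒x≡y j (subst (i ∈ˢ_) (injective eq) (x∈⁅x⁆ i)))
  where
  open IsWeakCopy w

  at : ∀ p → _
  at p = prop (𝓖⊆𝓕 (ψ-∈ p))

  empty : FinitePoset.Carrier S₂[ m ,0]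
  empty = ∅ , subst (_≤ 2) (sym (∣⊥∣≡0 m)) z≤n

  single : Fin m → FinitePoset.Carrier S₂[ m ,0]
  single i = ⁅ i ⁆ , subst (_≤ 2) (sym (∣⁅x⁆∣≡1 i)) (s≤s z≤n)

  -- For i = j this is a singleton, still an element of the poset, so the diagonal needs no separate
  -- treatment.
  pair : Fin m → Fin m → FinitePoset.Carrier S₂[ m ,0]
  pair i j = ⁅ i ⁆ ∪ ⁅ j ⁆ , ℕ.≤-trans (∥X∪Y∥≤ ⁅ i ⁆ ⁅ j ⁆)
    (ℕ.≤-reflexive (cong₂ _+_ (∣⁅x⁆∣≡1 i) (∣⁅x⁆∣≡1 j)))

  A = ψ empty
  B = ψ ∘ single

  pairs : ∀ i j → ∃ λ D → B i ⊆ D × B j ⊆ D × Independent M D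
  pairs i j = ψ (pair i j) , monotone (p⊆p∪q ⁅ j ⁆) , monotone (q⊆p∪q ⁅ i ⁆ ⁅ j ⁆) ,
              proj₂ (at (pair i j))

-- Independent sets in consecutive levels

levels : ℕ → ℕ → ℕ → ℕ
levels n lo zero    = 0
levels n lo (suc L) = levels n lo L + n C (lo + L)

inLevels? : ∀ {n} lo L (X : Subset n) → Dec (lo ≤ ∥ X ∥ × ∥ X ∥ < lo + L)
inLevels? lo L X = (lo ≤? ∥ X ∥) ×-dec (∥ X ∥ <? lo + L)

levels≤ : ∀ n lo L → levels n lo L ≤ ∑ {n} (λ X → ind (inLevels? lo L X))
levels≤ n lo zero    = z≤n
levels≤ n lo (suc L) = begin
  levels n lo L + n C (lo + L)
    ≤⟨ ℕ.+-mono-≤ (levels≤ n lo L) (ℕ.≤-reflexive (sym (∑-card n (lo + L)))) ⟩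
  ∑ {n} (λ X → ind (inLevels? lo L X)) + ∑ {n} (λ X → ind (∥ X ∥ ≟ lo + L))
    ≡⟨ ∑-+ {n} (λ X → ind (inLevels? lo L X)) (λ X → ind (∥ X ∥ ≟ lo + L)) ⟨
  ∑ {n} (λ X → ind (inLevels? lo L X) + ind (∥ X ∥ ≟ lo + L))
    ≤⟨ ∑-mono split ⟩
  ∑ {n} (λ X → ind (inLevels? lo (suc L) X)) ∎
  where
  open ℕ.≤-Reasoning
  bound : ∀ {x} → x ≤ lo + L → x < lo + suc L
  bound x≤ = ℕ.≤-trans (s≤s x≤) (ℕ.≤-reflexive (sym (ℕ.+-suc lo L)))

  split : ∀ (X : Subset n) → ind (inLevels? lo L X) + ind (∥ X ∥ ≟ lo + L) ≤
                             ind (inLevels? lo (suc L) X)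
  split X with ∥ X ∥ ≟ lo + L
  ... | yes eq = ℕ.≤-reflexive (trans
    (cong₂ _+_ (ind-¬ (inLevels? lo L X) λ (_ , lt) → ℕ.<-irrefl eq lt)
               (ind-yes (∥ X ∥ ≟ lo + L) eq))
    (sym (ind-yes (inLevels? lo (suc L) X)
      (ℕ.≤-trans (ℕ.m≤m+n lo L) (ℕ.≤-reflexive (sym eq)) , bound (ℕ.≤-reflexive eq)))))
  ... | no neq = ℕ.≤-trans
    (ℕ.≤-reflexive (trans (cong (ind (inLevels? lo L X) +_) (ind-¬ (∥ X ∥ ≟ lo + L) neq))
                          (ℕ.+-identityʳ _)))
    (ind-mono (inLevels? lo L X) (inLevels? lo (suc L) X) λ (l , u) → l , bound (ℕ.<⇒≤ u))

levels≤2La : ∀ n lo L {m} → 2 ^ (L ^ 2) < m → levels n lo L ≤ 2 * La n S₂[ m ,0]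
levels≤2La n lo L {m} m> = begin
  levels n lo L                              ≤⟨ levels≤ n lo L ⟩
  ∑ {n} (λ X → ind (inLevels? lo L X))       ≤⟨ proj₂ matrix ⟩
  2 * ∑ (ind ∘ P?)                           ≡⟨ cong (2 *_) (length-collect P?) ⟨
  2 * size (comprehension P?)                ≤⟨ ℕ.*-monoʳ-≤ 2 (bound (comprehension P?) free) ⟩
  2 * La n S₂[ m ,0]                         ∎
  where
  open ℕ.≤-Reasoning
  open IsMaxFreeSize (La-isMax n S₂[ m ,0])

  -- With `lo + L` rows, the upper end of the window gives the strict bound needed here, and the
  -- lower end gives `r ≤ L + |X|` in `prop`.
  matrix = mostly-independent (lo + L) (inLevels? {n} lo L) proj₂
  M = proj₁ matrix

  P : Subset n → Set
  P X = (lo ≤ ∥ X ∥ × ∥ X ∥ < lo + L) × ¬ Dependent M X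

  P? : ∀ X → Dec (P X)
  P? X = inLevels? lo L X ×-dec ¬? (dependent? M X)

  prop : ∀ {X} → X ∈ᶠ comprehension P? → lo + L ≤ L + ∥ X ∥ × Independent M X
  prop X∈ with collect-∈ P? X∈
  ... | (lo≤ , _) , ¬dep =
    ℕ.≤-trans (ℕ.≤-reflexive (ℕ.+-comm lo L)) (ℕ.+-monoʳ-≤ L lo≤) ,
    ¬dependent⇒independent M ¬dep

  free : Free S₂[ m ,0] (comprehension P?)
  free = independent-free L M m> (comprehension P?) prop

-- Binomial coefficients

-- The ratio (k+1) C(n,k+1) = (n-k) C(n,k) with the subtraction moved across, so that it also holds
-- for k > n.
C-absorb : ∀ n k → suc k * (n C suc k) + k * (n C k) ≡ n * (n C k)
C-absorb zero    k       = cong₂ _+_ (ℕ.*-zeroʳ (suc k)) (vanish k)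
  where
  vanish : ∀ k → k * (0 C k) ≡ 0
  vanish zero    = refl
  vanish (suc k) = ℕ.*-zeroʳ (suc k)
C-absorb (suc n) zero    = begin
  1 * (suc n C 1) + 0     ≡⟨ cong (λ c → 1 * c + 0) (nC1≡n (suc n)) ⟩
  1 * suc n + 0           ≡⟨ unit (suc n) ⟩
  suc n * 1               ∎
  where
  open ≡-Reasoning
  unit : ∀ n → 1 * n + 0 ≡ n * 1
  unit = solve-∀
C-absorb (suc n) (suc k) = begin
  suc (suc k) * (suc n C suc (suc k)) + suc k * (suc n C suc k)
    ≡⟨ cong₂ (λ x y → suc (suc k) * x + suc k * y)
         (nCk+nC[k+1]≡[n+1]C[k+1] n (suc k)) (nCk+nC[k+1]≡[n+1]C[k+1] n k) ⟨
  suc (suc k) * (b + c) + suc k * (a + b)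
    ≡⟨ regroup k a b c ⟩
  (suc (suc k) * c + suc k * b) + (suc k * b + k * a) + (a + b)
    ≡⟨ cong₂ (λ x y → x + y + (a + b)) (C-absorb n (suc k)) (C-absorb n k) ⟩
  n * b + n * a + (a + b)
    ≡⟨ collapse n a b ⟩
  suc n * (a + b)
    ≡⟨ cong (suc n *_) (nCk+nC[k+1]≡[n+1]C[k+1] n k) ⟩
  suc n * (suc n C suc k) ∎
  where
  open ≡-Reasoning
  a = n C k
  b = n C suc k
  c = n C suc (suc k)

  regroup : ∀ k a b c → suc (suc k) * (b + c) + suc k * (a + b) ≡
                        (suc (suc k) * c + suc k * b) + (suc k * b + k * a) + (a + b)
  regroup = solve-∀

  collapse : ∀ n a b → n * b + n * a + (a + b) ≡ suc n * (a + b)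
  collapse = solve-∀

2⌊n/2⌋≤n : ∀ n → 2 * ⌊ n /2⌋ ≤ n
2⌊n/2⌋≤n n = ℕ.≤-trans
  (ℕ.+-monoʳ-≤ ⌊ n /2⌋ (ℕ.≤-trans (ℕ.≤-reflexive (ℕ.+-identityʳ _)) (ℕ.⌊n/2⌋≤⌈n/2⌉ n)))
  (ℕ.≤-reflexive (ℕ.⌊n/2⌋+⌈n/2⌉≡n n))

n≤1+2⌊n/2⌋ : ∀ n → n ≤ suc (2 * ⌊ n /2⌋)
n≤1+2⌊n/2⌋ zero          = z≤n
n≤1+2⌊n/2⌋ (suc zero)    = s≤s z≤n
n≤1+2⌊n/2⌋ (suc (suc n)) = s≤s (ℕ.≤-trans (s≤s (n≤1+2⌊n/2⌋ n))
  (ℕ.≤-reflexive (shift ⌊ n /2⌋)))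
  where
  shift : ∀ h → suc (suc (2 * h)) ≡ 2 * suc h
  shift = solve-∀

C-antitone : ∀ n j → n C suc (⌊ n /2⌋ + j) ≤ n C (⌊ n /2⌋ + j)
C-antitone n j = ℕ.*-cancelˡ-≤ (suc (h + j)) (ℕ.+-cancelʳ-≤ ((h + j) * c) _ _ (begin
  suc (h + j) * (n C suc (h + j)) + (h + j) * c ≡⟨ C-absorb n (h + j) ⟩
  n * c                                         ≤⟨ ℕ.*-monoˡ-≤ c n≤ ⟩
  (suc (h + j) + (h + j)) * c                   ≡⟨ ℕ.*-distribʳ-+ c (suc (h + j)) (h + j) ⟩
  suc (h + j) * c + (h + j) * c                 ∎))
  where
  open ℕ.≤-Reasoning
  h = ⌊ n /2⌋
  c = n C (h + j)

  widen : ∀ h j → suc (2 * h) + 2 * j ≡ suc (h + j) + (h + j)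
  widen = solve-∀

  n≤ : n ≤ suc (h + j) + (h + j)
  n≤ = ℕ.≤-trans (n≤1+2⌊n/2⌋ n) (ℕ.≤-trans (ℕ.m≤m+n _ (2 * j)) (ℕ.≤-reflexive (widen h j)))

-- With c and c′ the two successive coefficients, (h+1+j) c′ = (n-h-j) c, where n ≥ 2h and c′ ≤ c,
-- gives (h+1) c′ ≥ (h-2j) c.
C-drop : ∀ n j → suc ⌊ n /2⌋ * (n C (⌊ n /2⌋ + j)) ≤
                 suc ⌊ n /2⌋ * (n C suc (⌊ n /2⌋ + j)) + suc (2 * j) * (n C (⌊ n /2⌋ + j))
C-drop n j = ℕ.+-cancelʳ-≤ (h * c) _ _ (begin
  suc h * c + h * c
    ≡⟨ collect₁ h c ⟩
  2 * h * c + c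
    ≤⟨ ℕ.+-monoˡ-≤ c (ℕ.*-monoˡ-≤ c (2⌊n/2⌋≤n n)) ⟩
  n * c + c
    ≡⟨ cong (_+ c) (C-absorb n (h + j)) ⟨
  suc (h + j) * c′ + (h + j) * c + c
    ≡⟨ collect₂ h j c c′ ⟩
  suc h * c′ + j * c′ + (h * c + j * c + c)
    ≤⟨ ℕ.+-monoˡ-≤ (h * c + j * c + c)
         (ℕ.+-monoʳ-≤ (suc h * c′) (ℕ.*-monoʳ-≤ j (C-antitone n j))) ⟩
  suc h * c′ + j * c + (h * c + j * c + c)
    ≡⟨ collect₃ h j c c′ ⟩
  suc h * c′ + suc (2 * j) * c + h * c ∎)
  where
  open ℕ.≤-Reasoning
  h = ⌊ n /2⌋
  c = n C (h + j)
  c′ = n C suc (h + j)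

  collect₁ : ∀ h c → suc h * c + h * c ≡ 2 * h * c + c
  collect₁ = solve-∀

  collect₂ : ∀ h j c c′ → suc (h + j) * c′ + (h + j) * c + c ≡
                          suc h * c′ + j * c′ + (h * c + j * c + c)
  collect₂ = solve-∀

  collect₃ : ∀ h j c c′ → suc h * c′ + j * c + (h * c + j * c + c) ≡
                          suc h * c′ + suc (2 * j) * c + h * c
  collect₃ = solve-∀

C-middle-max : ∀ n j → n C (⌊ n /2⌋ + j) ≤ n C ⌊ n /2⌋
C-middle-max n zero    = ℕ.≤-reflexive (cong (n C_) (ℕ.+-identityʳ ⌊ n /2⌋))
C-middle-max n (suc j) = ℕ.≤-trans (ℕ.≤-reflexive (cong (n C_) (ℕ.+-suc _ j)))
  (ℕ.≤-trans (C-antitone n j) (C-middle-max n j))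

-- The drops telescope, and 1 + 3 + ... + (2j-1) = j².
C-near-middle : ∀ n j → suc ⌊ n /2⌋ * (n C ⌊ n /2⌋) ≤
                        suc ⌊ n /2⌋ * (n C (⌊ n /2⌋ + j)) + j * j * (n C ⌊ n /2⌋)
C-near-middle n zero = ℕ.≤-reflexive (trans
  (cong (λ k → suc ⌊ n /2⌋ * (n C k)) (sym (ℕ.+-identityʳ ⌊ n /2⌋))) (sym (ℕ.+-identityʳ _)))
C-near-middle n (suc j) = begin
  suc h * c₀
    ≤⟨ C-near-middle n j ⟩
  suc h * c + j * j * c₀
    ≤⟨ ℕ.+-monoˡ-≤ (j * j * c₀) (C-drop n j) ⟩
  suc h * c′ + suc (2 * j) * c + j * j * c₀
    ≤⟨ ℕ.+-monoˡ-≤ (j * j * c₀)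
         (ℕ.+-monoʳ-≤ (suc h * c′) (ℕ.*-monoʳ-≤ (suc (2 * j)) (C-middle-max n j))) ⟩
  suc h * c′ + suc (2 * j) * c₀ + j * j * c₀
    ≡⟨ square j (suc h * c′) c₀ ⟩
  suc h * c′ + suc j * suc j * c₀
    ≡⟨ cong (λ k → suc h * (n C k) + suc j * suc j * c₀) (ℕ.+-suc h j) ⟨
  suc h * (n C (h + suc j)) + suc j * suc j * c₀ ∎
  where
  open ℕ.≤-Reasoning
  h = ⌊ n /2⌋
  c₀ = n C h
  c = n C (h + j)
  c′ = n C suc (h + j)

  square : ∀ j a c → a + suc (2 * j) * c + j * j * c ≡ a + suc j * suc j * c
  square = solve-∀

levels-large : ∀ n L → suc ⌊ n /2⌋ * (L * (n C ⌊ n /2⌋)) ≤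
                       suc ⌊ n /2⌋ * levels n ⌊ n /2⌋ L + L * L * L * (n C ⌊ n /2⌋)
levels-large n zero    = ℕ.≤-trans (ℕ.≤-reflexive (ℕ.*-zeroʳ (suc ⌊ n /2⌋))) z≤n
levels-large n (suc L) = begin
  suc h * (suc L * c₀)
    ≡⟨ expand h L c₀ ⟩
  suc h * (L * c₀) + suc h * c₀
    ≤⟨ ℕ.+-mono-≤ (levels-large n L) (C-near-middle n L) ⟩
  suc h * ℓ + L * L * L * c₀ + (suc h * c + L * L * c₀)
    -- The slack is (L+1)³ - L³ - L²: the sum of the squares below L is bounded by L³.
    ≤⟨ ℕ.m≤m+n _ ((2 * L * L + 3 * L + 1) * c₀) ⟩
  suc h * ℓ + L * L * L * c₀ + (suc h * c + L * L * c₀) + (2 * L * L + 3 * L + 1) * c₀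
    ≡⟨ cube h L ℓ c c₀ ⟩
  suc h * (ℓ + c) + suc L * suc L * suc L * c₀ ∎
  where
  open ℕ.≤-Reasoning
  h = ⌊ n /2⌋
  c₀ = n C h
  c = n C (h + L)
  ℓ = levels n h L

  expand : ∀ h L c₀ → suc h * (suc L * c₀) ≡ suc h * (L * c₀) + suc h * c₀
  expand = solve-∀

  cube : ∀ h L ℓ c c₀ →
    suc h * ℓ + L * L * L * c₀ + (suc h * c + L * L * c₀) + (2 * L * L + 3 * L + 1) * c₀ ≡
    suc h * (ℓ + c) + suc L * suc L * suc L * c₀
  cube = solve-∀

-- Integrality turns 2p < Ld into 2p + 1 ≤ Ld. The extra 1 contributes (h+1) C(n,h), which exceeds
-- the error L³d C(n,h) once h ≥ L³d; this dictates the threshold on n.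
La-large : ∀ L {m} → 2 ^ (L ^ 2) < m → ∀ p d → 2 * p < L * d →
           ∀ n → 2 * (L * L * L * d) ≤ n → p * (n C ⌊ n /2⌋) ≤ La n S₂[ m ,0] * d
La-large L {m} m> p d 2p< n n≥ = ℕ.*-cancelˡ-≤ (2 * suc h) (ℕ.+-cancelʳ-≤ (suc h * c₀) _ _ (begin
  2 * suc h * (p * c₀) + suc h * c₀
    ≡⟨ odd h p c₀ ⟩
  suc h * (suc (2 * p) * c₀)
    ≤⟨ ℕ.*-monoʳ-≤ (suc h) (ℕ.*-monoˡ-≤ c₀ 2p<) ⟩
  suc h * (L * d * c₀)
    ≡⟨ pull (suc h) L d c₀ ⟩
  d * (suc h * (L * c₀))
    ≤⟨ ℕ.*-monoʳ-≤ d (levels-large n L) ⟩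
  d * (suc h * ℓ + L * L * L * c₀)
    ≡⟨ split (suc h) ℓ d L c₀ ⟩
  suc h * (d * ℓ) + L * L * L * d * c₀
    ≤⟨ ℕ.+-mono-≤ (ℕ.*-monoʳ-≤ (suc h) (ℕ.*-monoʳ-≤ d (levels≤2La n h L m>)))
                  (ℕ.*-monoˡ-≤ c₀ (ℕ.m≤n⇒m≤1+n L³d≤h)) ⟩
  suc h * (d * (2 * la)) + suc h * c₀
    ≡⟨ cong (_+ suc h * c₀) (swap (suc h) d la) ⟩
  2 * suc h * (la * d) + suc h * c₀ ∎))
  where
  open ℕ.≤-Reasoning
  h = ⌊ n /2⌋
  c₀ = n C h
  ℓ = levels n h L
  la = La n S₂[ m ,0]

  L³d≤h : L * L * L * d ≤ h
  L³d≤h = ℕ.≤-trans (ℕ.≤-reflexive (trans (ℕ.n≡⌊n+n/2⌋ (L * L * L * d))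
                      (cong (λ k → ⌊ L * L * L * d + k /2⌋) (sym (ℕ.+-identityʳ _)))))
                    (ℕ.⌊n/2⌋-mono n≥)

  odd : ∀ h p c → 2 * suc h * (p * c) + suc h * c ≡ suc h * (suc (2 * p) * c)
  odd = solve-∀

  pull : ∀ s L d c → s * (L * d * c) ≡ d * (s * (L * c))
  pull = solve-∀

  split : ∀ s ℓ d L c → d * (s * ℓ + L * L * L * c) ≡ s * (d * ℓ) + L * L * L * d * c
  split = solve-∀

  swap : ∀ s d l → s * (d * (2 * l)) ≡ 2 * s * (l * d)
  swap = solve-∀

-- Rationals and reals

≤-/ : ∀ r a c .{{_ : NonZero c}} → ↥ r ℤ.* ⁺ c ℤ.≤ ⁺ a ℤ.* ↧ r → r ℚ.≤ ⁺ a ℚ./ c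
≤-/ r@record{} a (suc c) le = ℚ.toℚᵘ-cancel-≤
  (ℚᵘ.≤-respʳ-≃ (ℚᵘ.≃-sym (ℚ.toℚᵘ-fromℚᵘ (mkℚᵘ (⁺ a) c))) (ℚᵘ.*≤* le))

2ℚ : ℚ
2ℚ = ⁺ 2 ℚ./ 1

½2 : ∀ q → ½ ℚ.* (2ℚ ℚ.* q) ≡ q
½2 q = trans (sym (ℚ.*-assoc ½ 2ℚ q)) (ℚ.*-identityˡ q)

2½ : ∀ q → 2ℚ ℚ.* (½ ℚ.* q) ≡ q
2½ q = trans (sym (ℚ.*-assoc 2ℚ ½ q)) (ℚ.*-identityˡ q)

-- As r is nonnegative, L must be positive, so its absolute value may replace it.
2*-<⇒ : ∀ r {p} → ↥ r ≡ ⁺ p → (L : ℤ) → 2ℚ ℚ.* r ℚ.< L ℚ./ 1 → 2 * p < ∣ L ∣ * ℚ.↧ₙ r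
2*-<⇒ r@(mkℚ (⁺ p) d _) refl L lt = bound L (ℚᵘ.drop-*<* unnormalised)
  where
  unnormalised : mkℚᵘ (⁺ 2) 0 ℚᵘ.* mkℚᵘ (⁺ p) d ℚᵘ.< mkℚᵘ L 0
  unnormalised = ℚᵘ.<-respʳ-≃ (ℚ.toℚᵘ-fromℚᵘ (mkℚᵘ L 0))
    (ℚᵘ.<-respˡ-≃ (ℚ.toℚᵘ-homo-* 2ℚ r) (ℚ.toℚᵘ-mono-< lt))

  bound : ∀ L → (⁺ 2 ℤ.* ⁺ p) ℤ.* ⁺ 1 ℤ.< L ℤ.* ⁺ suc (d + 0) → 2 * p < ∣ L ∣ * suc d
  bound L lt with subst₂ ℤ._<_ (trans (ℤ.*-identityʳ _) (sym (ℤ.pos-* 2 p)))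
                              (cong (λ k → L ℤ.* ⁺ suc k) (ℕ.+-identityʳ d)) lt
  bound (⁺ l)    _ | lt′ = ℤ.drop‿+<+ (subst (⁺ (2 * p) ℤ.<_) (sym (ℤ.pos-* l (suc d))) lt′)
  bound -[1+ l ] _ | ()

La-ratio : ∀ L {m} → 2 ^ (∣ L ∣ ^ 2) < m → ∀ r → 2ℚ ℚ.* r ℚ.< L ℚ./ 1 →
           ∃ λ N → ∀ n → N ≤ n →
             r ℚ.≤ (⁺ La n S₂[ m ,0] ℚ./ (n C ⌊ n /2⌋)) {{nCk-nonZero (ℕ.⌊n/2⌋≤n n)}}
La-ratio L {m} m> r@(mkℚ (⁺ p) d _) 2r<L = 2 * (ℓ * ℓ * ℓ * suc d) , λ n n≥ →
  ≤-/ r (La n S₂[ m ,0]) (n C ⌊ n /2⌋) {{nCk-nonZero (ℕ.⌊n/2⌋≤n n)}}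
    (subst₂ ℤ._≤_ (ℤ.pos-* p (n C ⌊ n /2⌋)) (ℤ.pos-* (La n S₂[ m ,0]) (suc d))
      (ℤ.+≤+ (La-large ℓ m> p (suc d) (2*-<⇒ r refl L 2r<L) n n≥)))
  where ℓ = ∣ L ∣
-- A negative r lies below every ratio, from n = 0 on.
La-ratio L {m} m> r@(mkℚ -[1+ p ] d _) _ = 0 , λ n _ →
  ≤-/ r (La n S₂[ m ,0]) (n C ⌊ n /2⌋) {{nCk-nonZero (ℕ.⌊n/2⌋≤n n)}}
    (ℤ.≤-trans (negative (n C ⌊ n /2⌋))
      (subst (⁺ 0 ℤ.≤_) (ℤ.pos-* (La n S₂[ m ,0]) (suc d)) (ℤ.+≤+ z≤n)))
  where
  negative : ∀ c → -[1+ p ] ℤ.* ⁺ c ℤ.≤ ⁺ 0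
  negative zero    = ℤ.≤-reflexive (ℤ.*-zeroʳ -[1+ p ])
  negative (suc c) = ℤ.-≤+

below-π⁻ : ∀ K L → 2· K <ʳ fromℤ L → K <ˡ π⁻ S₂[ 2 ^ (∣ L ∣ ^ 2) + 1 ,0]
-- Lying below the limit inferior requires a strictly larger bound for the tail, hence a rational
-- between q and L.
below-π⁻ K L (q , above , q<L) with ℚ.<-dense q<L
... | r , q<r , r<L = ½ ℚ.* q , above , ½ ℚ.* r , ℚ.*-monoʳ-<-pos ½ q<r ,
  La-ratio L (ℕ.≤-reflexive (ℕ.+-comm 1 _)) (½ ℚ.* r) (subst (ℚ._< L ℚ./ 1) (sym (2½ r)) r<L)

archimedean : ∀ q → ∃ λ L → q ℚ.< L ℚ./ 1
archimedean q@(mkℚ n d _) = ⁺ suc ∣ n ∣ , ℚ.toℚᵘ-cancel-<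
  (ℚᵘ.<-respʳ-≃ (ℚᵘ.≃-sym (ℚ.toℚᵘ-fromℚᵘ (mkℚᵘ (⁺ suc ∣ n ∣) 0))) (ℚᵘ.*<* (bound n)))
  where
  bound : ∀ n → n ℤ.* ⁺ 1 ℤ.< ⁺ suc ∣ n ∣ ℤ.* ⁺ suc d
  bound (⁺ p)    = subst (ℤ._< ⁺ (suc p * suc d)) (sym (ℤ.*-identityʳ (⁺ p)))
    (ℤ.+<+ (ℕ.m≤m*n (suc p) (suc d)))
  bound -[1+ p ] = ℤ.-<+

theorem4 : (K : ℝ) → 0ℝ <ʳ K →
    (∃ λ (m : ℕ) → 2 ≤ m × K <ˡ π⁻ S₂[ m ,0])
    × (∀ (L : ℤ) → 2· K <ʳ fromℤ L → K <ˡ π⁻ S₂[ 2 ^ (∣ L ∣ ^ 2) + 1 ,0])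
theorem4 K _ = (2 ^ (∣ L ∣ ^ 2) + 1 , ℕ.+-monoˡ-≤ 1 (ℕ.m^n>0 2 (∣ L ∣ ^ 2)) , below-π⁻ K L 2K<L)
             , below-π⁻ K
  where
  -- The upper cut of a Dedekind real is inhabited, so some integer exceeds 2K.
  a = proj₁ (ℝ.above-inhab K)
  L = proj₁ (archimedean (2ℚ ℚ.* a))

  2K<L : 2· K <ʳ fromℤ L
  2K<L = 2ℚ ℚ.* a , subst (ℝ.Above K) (sym (½2 a)) (proj₂ (ℝ.above-inhab K)) ,
         proj₂ (archimedean (2ℚ ℚ.* a))
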